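{- Let $G$ be a finite (weighted di)graph with adjacency matrix $\mathsf{A}$. Let $H$ be an induced subgraph of $G$ and let $\mathcal{P}_H$ be the set of primes (simple cycles) on $H$. Let $\mathcal{H}$ be the set of hikes on $G$ and let $\rho:\mathcal{H}\to\mathbb{R}$ be a rank function on hikes such that $|\mathcal{H}_\varrho|=\lambda^{\varrho}f(\varrho)$, with $\lambda$ a real constant and $f$ a bounded function such that $\lim_{\varrho\to\infty}f(\varrho)$ exists. Then the number (weight) $S(\mathcal{H}_\varrho,\mathcal{P}_H)$ of hikes $h$ of rank $\rho(h)=\varrho$ which are not multiples of primes on $H$ is asymptotically given by $$\frac{S(\mathcal{H}_\varrho,\mathcal{P}_H)}{|\mathcal{H}_\varrho|}\sim\sum_{d\in\mathcal{P}_H^{s.a.}}\mu(d)\,\lambda^{ -\rho(d)},\qquad\text{as }\varrho\to\infty.$$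
   Context: A simple cycle (prime) is a closed walk visiting no vertex twice, up to choice of starting point, orientations being distinguished. Hikes are the elements of the trace monoid $\mathcal{H}$ generated by the simple cycles of $G$, where two simple cycles commute if and only if they are vertex-disjoint; the empty hike is $1$. A hike $h$ is a (left-)multiple of a hike $d$, equivalently $d$ right-divides $h$, if $h=h'd$ for some hike $h'$; "not multiples of primes on $H$" means not right-divisible by any prime in $\mathcal{P}_H$. A rank function is a function $\rho:\mathcal{H}\to\mathbb{R}$ that is totally additive, $\rho(hh')=\rho(h)+\rho(h')$, and respects the divisibility order ($h$ divides $h'$ implies $\rho(h)\le\rho(h')$). $\mathcal{H}_\varrho=\{h\in\mathcal{H}:\rho(h)=\varrho\}$ and $|\mathcal{H}_\varrho|$ is its cardinality; if the graph is weighted, this is understood to mean the total weight carried by the hikes of rank $\varrho$. A self-avoiding hike is a product of pairwise vertex-disjoint simple cycles (the empty hike $1$ included); $\mathcal{P}_H^{s.a.}$ is the set of all self-avoiding hikes that can be built from cycles of $\mathcal{P}_H$. The Möbius function on hikes is $\mu(h)=(-1)^{\Omega(h)}$ if $h$ is self-avoiding with $\Omega(h)$ prime factors, and $\mu(h)=0$ otherwise.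
   Formalization: The limit of f is assumed non-zero and each d in the right-hand sum also carries its weight w(d) (both needed: the claim fails otherwise); λ > 0, each set of hikes of rank ϱ is finite, and ϱ ranges over the additive group generated by the ranks. -}

module Defs where

open import Level using (Level; _⊔_) renaming (suc to lsuc)
open import Algebra.Apartness.Bundles using (HeytingField; HeytingCommutativeRing)
open import Algebra.Bundles using (CommutativeRing; Semiring)
import Algebra.Definitions.RawMonoid as RawMonoidOps
import Algebra.Definitions.RawSemiring as RawSemiringOps
open import Data.Bool using (if_then_else_)
open import Data.Fin using (Fin)
open import Data.Fin.Properties using (_≟_)
open import Data.Fin.Subset using (Subset) renaming (_∈_ to _∈ₛ_)
open import Data.List using (List; []; _∷_; _++_; [_]; map; foldr; zip; length)
open import Data.List.Relation.Binary.Disjoint.DecPropositional using (disjoint?)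
open import Data.List.Relation.Binary.Disjoint.Propositional using (Disjoint)
open import Data.List.Relation.Unary.All using (All)
open import Data.List.Relation.Unary.AllPairs using (AllPairs; allPairs?)
open import Data.List.Relation.Unary.Any using (Any)
open import Data.List.Relation.Unary.Unique.Propositional using (Unique)
open import Data.Nat using (ℕ) renaming (_≤_ to _≤ℕ_)
open import Data.Product using (Σ; ∃; ∃₂; ∃-syntax; _×_; _,_; proj₁; uncurry)
open import Data.Sum using (_⊎_)
open import Relation.Binary using (Rel; IsStrictPartialOrder)
open import Relation.Binary.PropositionalEquality using (_≡_)
open import Relation.Nullary using (¬_; Dec; does)
open import Relation.Unary using (Pred)

-- ℝ is taken axiomatically, as a Cauchy-complete Archimedean ordered field.
-- Classically any two such fields are isomorphic; constructively the Cauchy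
-- reals are an instance.
record RealField (c ℓ₁ ℓ₂ : Level) : Set (lsuc (c ⊔ ℓ₁ ⊔ ℓ₂)) where
  infix 4 _<_ _≤_
  field
    heytingField : HeytingField c ℓ₁ ℓ₂

  open HeytingField heytingField public

  commutativeRing : CommutativeRing c ℓ₁
  commutativeRing = HeytingCommutativeRing.commutativeRing heytingCommutativeRing

  open RawMonoidOps (CommutativeRing.+-rawMonoid commutativeRing) public
    using () renaming (_×_ to _⋆_)
  open RawSemiringOps (Semiring.rawSemiring (CommutativeRing.semiring commutativeRing)) public
    using (_^_)

  field
    _<_                  : Rel Carrier ℓ₂
    isStrictPartialOrder : IsStrictPartialOrder _≈_ _<_
    #⇒<⊎>                : ∀ {x y} → x # y → x < y ⊎ y < x
    <⇒#                  : ∀ {x y} → x < y → x # y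
    +-monoˡ-<            : ∀ {x y} z → x < y → x + z < y + z
    *-pos                : ∀ {x y} → 0# < x → 0# < y → 0# < x * y
    archimedean          : ∀ x → ∃[ n ] x < n ⋆ 1#

  _≤_ : Rel Carrier ℓ₂
  x ≤ y = ¬ (y < x)

  ∣_-_∣<_ : Carrier → Carrier → Carrier → Set ℓ₂
  ∣ x - y ∣< ε = (x < y + ε) × (y < x + ε)

  IsCauchy : (ℕ → Carrier) → Set (c ⊔ ℓ₂)
  IsCauchy s = ∀ ε → 0# < ε →
    ∃[ N ] (∀ m n → N ≤ℕ m → N ≤ℕ n → ∣ s m - s n ∣< ε)

  ConvergesTo : (ℕ → Carrier) → Carrier → Set (c ⊔ ℓ₂)
  ConvergesTo s l = ∀ ε → 0# < ε → ∃[ N ] (∀ n → N ≤ℕ n → ∣ s n - l ∣< ε)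

  field
    complete : ∀ s → IsCauchy s → ∃[ l ] ConvergesTo s l

  -- The library's #⇒invertible supplies an inverse of y - 0#.
  divide : ∀ (x y : Carrier) → y # 0# → Carrier
  divide x y y#0 = x * proj₁ (#⇒invertible y#0)

  -- x ↦ bˣ on ℝ, for b > 0: the unique continuous solution of
  -- bˣ⁺ʸ = bˣ bʸ with b¹ = b.
  record IsExponential (b : Carrier) (pow : Carrier → Carrier)
         : Set (c ⊔ ℓ₁ ⊔ ℓ₂) where
    field
      pow-cong   : ∀ {x y} → x ≈ y → pow x ≈ pow y
      pow-1      : pow 1# ≈ b
      pow-+      : ∀ x y → pow (x + y) ≈ pow x * pow y
      continuous : ∀ x ε → 0# < ε → ∃[ δ ] ((0# < δ) ×
                     (∀ y → ∣ y - x ∣< δ → ∣ pow y - pow x ∣< ε))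

module _ {c ℓ₁ ℓ₂ : Level} (R : RealField c ℓ₁ ℓ₂) where

  open RealField R

  -- There is an arc i → j exactly when the entry A i j is non-zero; loops are
  -- allowed.  An unweighted graph has all entries 0# or 1#, an undirected one
  -- has A symmetric.
  record WeightedDigraph : Set (c ⊔ ℓ₁ ⊔ ℓ₂) where
    field
      order : ℕ
      A     : Fin order → Fin order → Carrier
      arc?  : ∀ i j → A i j ≈ 0# ⊎ A i j # 0#

    Vertex : Set
    Vertex = Fin order

    Arc : Vertex → Vertex → Set ℓ₂
    Arc i j = A i j # 0#

module Hikes {c ℓ₁ ℓ₂ : Level} (R : RealField c ℓ₁ ℓ₂) (G : WeightedDigraph R) where

  open RealField R
  open WeightedDigraph G

  -- A simple cycle with a chosen starting point; the choice is forgotten by _~_.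
  record Cycle : Set ℓ₂ where
    field
      start : Vertex
      rest  : List Vertex

    vertices : List Vertex
    vertices = start ∷ rest

    arcs : List (Vertex × Vertex)
    arcs = zip vertices (rest ++ [ start ])

    field
      distinct : Unique vertices
      closed   : All (uncurry Arc) arcs

  open Cycle using (vertices; arcs)

  infix 4 _~_ _≈ₕ_ _∣ᵣ_

  _~_ : Rel Cycle _
  p ~ q = ∃₂ λ xs ys → (vertices p ≡ xs ++ ys) × (vertices q ≡ ys ++ xs)

  VertexDisjoint : Rel Cycle _
  VertexDisjoint p q = Disjoint (vertices p) (vertices q)

  -- The trace monoid: words in the simple cycles modulo _≈ₕ_, with product
  -- _++_ and unit [].
  Hike : Set ℓ₂
  Hike = List Cycle

  data _≈ₕ_ : Rel Hike ℓ₂ where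
    ≈-nil   : [] ≈ₕ []
    ≈-cons  : ∀ {p q h k} → p ~ q → h ≈ₕ k → p ∷ h ≈ₕ q ∷ k
    ≈-swap  : ∀ {p q} h → VertexDisjoint p q → p ∷ q ∷ h ≈ₕ q ∷ p ∷ h
    ≈-sym   : ∀ {h k} → h ≈ₕ k → k ≈ₕ h
    ≈-trans : ∀ {h k l} → h ≈ₕ k → k ≈ₕ l → h ≈ₕ l

  _∣ᵣ_ : Rel Hike ℓ₂
  d ∣ᵣ h = ∃[ h′ ] h ≈ₕ h′ ++ d

  weightᶜ : Cycle → Carrier
  weightᶜ p = foldr _*_ 1# (map (uncurry A) (arcs p))

  -- On an unweighted graph every hike has weight 1#, so totals of weights are
  -- cardinalities.
  weight : Hike → Carrier
  weight h = foldr _*_ 1# (map weightᶜ h)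

  SelfAvoiding : Pred Hike _
  SelfAvoiding = AllPairs VertexDisjoint

  selfAvoiding? : ∀ h → Dec (SelfAvoiding h)
  selfAvoiding? = allPairs? (λ p q → disjoint? _≟_ (vertices p) (vertices q))

  Ω : Hike → ℕ
  Ω = length

  μ : Hike → Carrier
  μ h = if does (selfAvoiding? h) then (- 1#) ^ Ω h else 0#

  -- The induced subgraph H is given by its vertex set.
  IsPrimeOn : Subset order → Pred Cycle _
  IsPrimeOn H p = All (_∈ₛ H) (vertices p)

  SelfAvoidingOn : Subset order → Pred Hike _
  SelfAvoidingOn H d = SelfAvoiding d × All (IsPrimeOn H) d

  NotMultipleOfPrimeOn : Subset order → Pred Hike _
  NotMultipleOfPrimeOn H h = ∀ p → IsPrimeOn H p → ¬ ([ p ] ∣ᵣ h)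

  -- The hikes satisfying P are finitely many and Σ_{h ∈ P} g h = s; the list
  -- contains exactly one representative word of each such hike.
  HasTotal : ∀ {ℓ} → Pred Hike ℓ → (Hike → Carrier) → Carrier → Set (ℓ₁ ⊔ ℓ₂ ⊔ ℓ)
  HasTotal P g s = Σ (List Hike) λ hs →
    All P hs ×
    (∀ h → P h → Any (h ≈ₕ_) hs) ×
    AllPairs (λ h k → ¬ (h ≈ₕ k)) hs ×
    (s ≈ foldr _+_ 0# (map g hs))

  record RankFunction : Set (c ⊔ ℓ₁ ⊔ ℓ₂) where
    field
      rank     : Hike → Carrier
      cong     : ∀ {h k} → h ≈ₕ k → rank h ≈ rank k
      additive : ∀ h k → rank (h ++ k) ≈ rank h + rank k
      monotone : ∀ {d h} → d ∣ᵣ h → rank d ≤ rank h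

  module Ranked (ρ : RankFunction) where

    open RankFunction ρ using (rank)

    -- ϱ ranges over the additive subgroup of ℝ generated by the ranks of hikes
    -- (ℤ for the length on a graph with coprime cycle lengths).  If it ranged
    -- over all of ℝ then |ℋ_ϱ| would vanish at arbitrarily large ϱ, since ρ
    -- takes only countably many values.
    Rank : Set (c ⊔ ℓ₁ ⊔ ℓ₂)
    Rank = Σ Carrier λ ϱ → ∃₂ λ h k → ϱ ≈ rank h - rank k

    value : Rank → Carrier
    value = proj₁

    OfRank : Rank → Pred Hike ℓ₁
    OfRank ϱ h = rank h ≈ value ϱ

    Bounded : (Rank → Carrier) → Set (c ⊔ ℓ₁ ⊔ ℓ₂)
    Bounded f = ∃[ b ] (∀ ϱ → (- b ≤ f ϱ) × (f ϱ ≤ b))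

    Tendsto : (Rank → Carrier) → Carrier → Set (c ⊔ ℓ₁ ⊔ ℓ₂)
    Tendsto f l = ∀ ε → 0# < ε →
      ∃[ N ] (∀ ϱ → N < value ϱ → ∣ f ϱ - l ∣< ε)

    -- f ϱ / g ϱ is defined for all large ϱ and tends to l.
    RatioTendsto : (Rank → Carrier) → (Rank → Carrier) → Carrier →
                   Set (c ⊔ ℓ₁ ⊔ ℓ₂)
    RatioTendsto f g l = ∀ ε → 0# < ε →
      ∃[ N ] (∀ ϱ → N < value ϱ →
        Σ (g ϱ # 0#) λ g#0 → ∣ divide (f ϱ) (g ϱ) g#0 - l ∣< ε)

{-# OPTIONS --safe #-}

-- Let T L ϱ be the total weight of the hikes of rank ϱ divisible by none of the
-- primes in a list L, and C L the sum of μ(d) w(d) b^(-ρ(d)) over the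
-- self-avoiding hikes d made of primes in L.  A hike divisible by p is uniquely
-- h p, and a prime q ≠ p divides h p exactly when q divides h and is disjoint
-- from p.  With p ⊥ L the primes of L disjoint from p this gives
--   T (p ∷ L) ϱ = T L ϱ - w(p) T (p ⊥ L) (ϱ - ρ(p)),
-- and C satisfies the same recursion with b^(-ρ(p)) in place of the shift of ϱ.
-- By induction on the length of L, b^(-ϱ) T L ϱ tends to l C L.
module Submission where

-- A prime other than `p` that meets `p` cannot be moved past a final `p`: it never divides `h p`
-- and so puts no condition on `h`. This is why `p ⊥ L` appears. Likewise a self-avoiding hike
-- containing `p` is `p` times one built from primes disjoint from `p`, so `C` splits in the same
-- way, with no inclusion-exclusion over sets of primes. The delicate point is uniqueness of the
-- factorisation `h p`: a derivation of `≈ₕ` may pass through arbitrary words, so cancellation is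
-- obtained by following the last occurrence of `p` through it. A shift of the rank does not change
-- a limit, and `b^(-ϱ)` is `b^(-(ϱ - ρ(p)))` times `b^(-ρ(p))`; this produces `b^(-ρ(d))`, while
-- `w(d)` collects the weights of the primes split off. Weights may be negative, so nothing rests on
-- monotonicity: each step is an exact identity followed by a linear limit. Division by the total of
-- all hikes comes last, where `l # 0#` keeps `f` away from zero at large ranks.

open import Defs
open import Level using (Level)
open import Algebra.Bundles using (CommutativeRing)
import Algebra.Apartness.Properties.HeytingCommutativeRing as HeytingProperties
import Algebra.Properties.AbelianGroup as AbelianGroupProperties
import Algebra.Properties.Ring as RingProperties
import Algebra.Properties.Semiring.Mult as SemiringMult
import Algebra.Solver.Ring as RingSolver
open import Algebra.Solver.Ring.AlmostCommutativeRing
  using (fromCommutativeRing; _-Raw-AlmostCommutative⟶_)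
open import Data.Empty using (⊥-elim)
open import Data.Fin using (Fin; zero; suc)
import Data.Fin.Properties as Fin
open import Data.Fin.Subset using (Subset)
open import Data.Fin.Subset.Properties using (_∈?_)
open import Data.Integer using (ℤ; +_; -[1+_])
import Data.Integer as ℤ
import Data.Integer.Properties as ℤ
open import Data.List
  using (List; []; _∷_; _++_; [_]; map; foldr; zip; length; filter; lookup; take; drop;
         allFin; cartesianProductWith; deduplicate)
import Data.List.Properties as List
open import Data.List.Membership.Propositional using (_∈_)
open import Data.List.Membership.Propositional.Properties
  using (∈-allFin; ∈-cartesianProductWith⁺; ∈-filter⁺; ∈-++⁺ˡ; ∈-++⁺ʳ; ∈-++⁻; ∈-lookup)
import Data.List.Membership.Setoid as SetoidMembership
import Data.List.Membership.Setoid.Properties as ∈ₚ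
open import Data.List.Relation.Binary.Disjoint.DecPropositional using (disjoint?)
import Data.List.Relation.Binary.Permutation.Setoid as SetoidPermutation
import Data.List.Relation.Binary.Permutation.Setoid.Properties as ↭ₚ
open import Data.List.Relation.Unary.All as All using (All; []; _∷_)
import Data.List.Relation.Unary.All.Properties as All
open import Data.List.Relation.Unary.AllPairs as AllPairs using (AllPairs; []; _∷_)
import Data.List.Relation.Unary.AllPairs.Properties as AllPairs
open import Data.List.Relation.Unary.Any as Any using (Any; here; there)
import Data.List.Relation.Unary.Any.Properties as Any
import Data.List.Relation.Unary.Unique.DecPropositional as DecUnique
open import Data.List.Relation.Unary.Unique.DecSetoid.Properties using (deduplicate-!)
open import Data.List.Relation.Unary.Unique.Propositional using (Unique)
import Data.List.Relation.Unary.Unique.Setoid as SetoidUnique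
open import Data.Maybe as Maybe using (Maybe)
open import Data.Nat using (ℕ; zero; suc; s≤s) renaming (_≤_ to _≤ℕ_)
import Data.Nat as ℕ
import Data.Nat.Properties as ℕ
open import Data.Product using (∃₂; ∃-syntax; _×_; _,_; proj₁; proj₂; uncurry; swap)
open import Data.Sum using (_⊎_; inj₁; inj₂)
open import Function using (_∘_; id; case_of_; _⟨_⟩_)
open import Relation.Binary
  using (Setoid; DecSetoid; IsStrictPartialOrder; _Respects_)
import Relation.Binary.PropositionalEquality as ≡
open ≡ using (_≡_)
import Relation.Binary.Reasoning.Setoid as ≈-Reasoning
open import Relation.Nullary using (¬_; Dec; yes; no; ¬?; contradiction)
open import Relation.Nullary.Decidable using (map′; _×-dec_; dec-true; dec⇒maybe)
open import Relation.Unary using (Pred; Decidable)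

-- Integer coefficients are what lets the ring solver see that x - x vanishes.
module IntegerSolver {c ℓ : Level} (CR : CommutativeRing c ℓ) where

  open CommutativeRing CR
  open RingProperties ring
  open AbelianGroupProperties +-abelianGroup using (⁻¹-∙-comm)
  open SemiringMult semiring using (×-homo-+; ×1-homo-*) renaming (_×_ to _⋆_)
  open ≈-Reasoning setoid

  fromℤ : ℤ → Carrier
  fromℤ (+ n)    = n ⋆ 1#
  fromℤ -[1+ n ] = - (suc n ⋆ 1#)

  fromℤ-⊖ : ∀ m n → fromℤ (m ℤ.⊖ n) ≈ m ⋆ 1# - n ⋆ 1#
  fromℤ-⊖ m       zero    = sym (trans (+-congˡ -0#≈0#) (+-identityʳ _))
  fromℤ-⊖ zero    (suc n) = sym (+-identityˡ _)
  fromℤ-⊖ (suc m) (suc n) = begin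
    fromℤ (suc m ℤ.⊖ suc n)                 ≡⟨ ≡.cong fromℤ (ℤ.[1+m]⊖[1+n]≡m⊖n m n) ⟩
    fromℤ (m ℤ.⊖ n)                         ≈⟨ fromℤ-⊖ m n ⟩
    m ⋆ 1# - n ⋆ 1#                         ≈⟨ +-congʳ (+-identityˡ _) ⟨
    0# + m ⋆ 1# - n ⋆ 1#                    ≈⟨ +-congʳ (+-congʳ (-‿inverseʳ 1#)) ⟨
    1# - 1# + m ⋆ 1# - n ⋆ 1#               ≈⟨ +-congʳ (+-assoc _ _ _) ⟩
    1# + (- 1# + m ⋆ 1#) - n ⋆ 1#           ≈⟨ +-congʳ (+-congˡ (+-comm _ _)) ⟩
    1# + (m ⋆ 1# - 1#) - n ⋆ 1#             ≈⟨ +-congʳ (+-assoc _ _ _) ⟨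
    1# + m ⋆ 1# - 1# - n ⋆ 1#               ≈⟨ +-assoc _ _ _ ⟩
    1# + m ⋆ 1# + (- 1# - n ⋆ 1#)           ≈⟨ +-congˡ (⁻¹-∙-comm _ _) ⟩
    1# + m ⋆ 1# - (1# + n ⋆ 1#)             ∎

  fromℤ-neg : ∀ i → fromℤ (ℤ.- i) ≈ - fromℤ i
  fromℤ-neg (+ zero)    = sym -0#≈0#
  fromℤ-neg (+ (suc n)) = refl
  fromℤ-neg -[1+ n ]    = sym (-‿involutive _)

  fromℤ-+ : ∀ i j → fromℤ (i ℤ.+ j) ≈ fromℤ i + fromℤ j
  fromℤ-+ (+ m)    (+ n)    = ×-homo-+ 1# m n
  fromℤ-+ (+ m)    -[1+ n ] = fromℤ-⊖ m (suc n)
  fromℤ-+ -[1+ m ] (+ n)    = trans (fromℤ-⊖ n (suc m)) (+-comm _ _)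
  fromℤ-+ -[1+ m ] -[1+ n ] = begin
    - (suc (suc (m ℕ.+ n)) ⋆ 1#)       ≡⟨ ≡.cong (λ k → - (suc k ⋆ 1#)) (ℕ.+-suc m n) ⟨
    - ((suc m ℕ.+ suc n) ⋆ 1#)         ≈⟨ -‿cong (×-homo-+ 1# (suc m) (suc n)) ⟩
    - (suc m ⋆ 1# + suc n ⋆ 1#)        ≈⟨ ⁻¹-∙-comm _ _ ⟨
    - (suc m ⋆ 1#) - suc n ⋆ 1#        ∎

  fromℤ-+* : ∀ m j → fromℤ (+ m ℤ.* j) ≈ fromℤ (+ m) * fromℤ j
  fromℤ-+* m (+ n)    = begin
    fromℤ (+ m ℤ.* + n)    ≡⟨ ≡.cong fromℤ (ℤ.pos-* m n) ⟨
    (m ℕ.* n) ⋆ 1#         ≈⟨ ×1-homo-* m n ⟩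
    m ⋆ 1# * (n ⋆ 1#)      ∎
  fromℤ-+* m -[1+ n ] = begin
    fromℤ (+ m ℤ.* -[1+ n ])            ≡⟨ ≡.cong fromℤ (ℤ.neg-distribʳ-* (+ m) (+ suc n)) ⟨
    fromℤ (ℤ.- (+ m ℤ.* + suc n))       ≈⟨ fromℤ-neg (+ m ℤ.* + suc n) ⟩
    - fromℤ (+ m ℤ.* + suc n)           ≈⟨ -‿cong (fromℤ-+* m (+ suc n)) ⟩
    - (m ⋆ 1# * (suc n ⋆ 1#))           ≈⟨ -‿distribʳ-* _ _ ⟩
    m ⋆ 1# * - (suc n ⋆ 1#)             ∎

  fromℤ-* : ∀ i j → fromℤ (i ℤ.* j) ≈ fromℤ i * fromℤ j
  fromℤ-* (+ m)    j = fromℤ-+* m j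
  fromℤ-* -[1+ m ] j = begin
    fromℤ (-[1+ m ] ℤ.* j)              ≡⟨ ≡.cong fromℤ (ℤ.neg-distribˡ-* (+ suc m) j) ⟨
    fromℤ (ℤ.- (+ suc m ℤ.* j))         ≈⟨ fromℤ-neg (+ suc m ℤ.* j) ⟩
    - fromℤ (+ suc m ℤ.* j)             ≈⟨ -‿cong (fromℤ-+* (suc m) j) ⟩
    - (suc m ⋆ 1# * fromℤ j)            ≈⟨ -‿distribˡ-* _ _ ⟩
    - (suc m ⋆ 1#) * fromℤ j            ∎

  morphism : ℤ.+-*-rawRing -Raw-AlmostCommutative⟶ fromCommutativeRing CR
  morphism = record
    { ⟦_⟧    = fromℤ
    ; +-homo = fromℤ-+
    ; *-homo = fromℤ-*
    ; -‿homo = fromℤ-neg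
    ; 0-homo = refl
    ; 1-homo = +-identityʳ 1#
    }

  _coeff≟_ : ∀ i j → Maybe (fromℤ i ≈ fromℤ j)
  i coeff≟ j = Maybe.map (λ { ≡.refl → refl }) (dec⇒maybe (i ℤ.≟ j))

  open RingSolver ℤ.+-*-rawRing (fromCommutativeRing CR) morphism _coeff≟_ public
    using (solve; _:=_; _:+_; _:-_; _:*_; :-_; con)

-- Inequalities and inverses in the real field.

module RealFieldProperties {c ℓ₁ ℓ₂ : Level} (R : RealField c ℓ₁ ℓ₂) where

  open RealField R
  open HeytingProperties heytingCommutativeRing using (1#0; x-0≈x; invertibleˡ⇒#)
  open IntegerSolver commutativeRing public
  private module <-Order = IsStrictPartialOrder isStrictPartialOrder

  -- Abstract because ring-solver proofs have huge normal forms.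
  abstract

    <-trans : ∀ {x y z} → x < y → y < z → x < z
    <-trans = <-Order.trans

    <-irrefl : ∀ {x} → ¬ (x < x)
    <-irrefl = <-Order.irrefl refl

    <-resp-≈ : ∀ {x x′ y y′} → x ≈ x′ → y ≈ y′ → x < y → x′ < y′
    <-resp-≈ x≈x′ y≈y′ x<y = <-Order.<-respʳ-≈ y≈y′ (<-Order.<-respˡ-≈ x≈x′ x<y)

    +-monoʳ-< : ∀ z {x y} → x < y → z + x < z + y
    +-monoʳ-< z x<y = <-resp-≈ (+-comm _ z) (+-comm _ z) (+-monoˡ-< z x<y)

    +-mono-< : ∀ {x y u v} → x < y → u < v → x + u < y + v
    +-mono-< {y = y} {u} x<y u<v = <-trans (+-monoˡ-< u x<y) (+-monoʳ-< y u<v)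

    x<y⇒0<y-x : ∀ {x y} → x < y → 0# < y - x
    x<y⇒0<y-x {x} x<y = <-resp-≈ (-‿inverseʳ x) refl (+-monoˡ-< (- x) x<y)

    0<y-x⇒x<y : ∀ {x y} → 0# < y - x → x < y
    0<y-x⇒x<y {x} {y} 0<y-x = <-resp-≈ (+-identityˡ x)
      (solve 2 (λ x y → y :- x :+ x := y) refl x y) (+-monoˡ-< x 0<y-x)

    *-monoʳ-< : ∀ {z x y} → 0# < z → x < y → z * x < z * y
    *-monoʳ-< {z} {x} {y} 0<z x<y = 0<y-x⇒x<y (<-resp-≈ refl
      (solve 3 (λ z x y → z :* (y :- x) := z :* y :- z :* x) refl z x y)
      (*-pos 0<z (x<y⇒0<y-x x<y)))

    0<x*x : ∀ {x} → x # 0# → 0# < x * x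
    0<x*x {x} x#0 with #⇒<⊎> x#0
    ... | inj₂ 0<x = *-pos 0<x 0<x
    ... | inj₁ x<0 = <-resp-≈ refl
      (solve 1 (λ x → (con (+ 0) :- x) :* (con (+ 0) :- x) := x :* x) refl x)
      (*-pos (x<y⇒0<y-x x<0) (x<y⇒0<y-x x<0))

    0<1 : 0# < 1#
    0<1 = <-resp-≈ refl (*-identityˡ 1#) (0<x*x 1#0)

    inverse#0 : ∀ {x} y → y * x ≈ 1# → x # 0#
    inverse#0 {x} y yx≈1 = invertibleˡ⇒# (y , trans (*-congˡ (x-0≈x x)) yx≈1)

    reciprocal : ∀ {x} (x#0 : x # 0#) → proj₁ (#⇒invertible x#0) * x ≈ 1#
    reciprocal {x} x#0 with #⇒invertible x#0
    ... | y , y[x-0]≈1 , _ = trans (*-congˡ (sym (x-0≈x x))) y[x-0]≈1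

    positive-inverse : ∀ {x} → 0# < x → ∃[ y ] 0# < y × y * x ≈ 1#
    positive-inverse {x} 0<x with #-sym (<⇒# 0<x)
    ... | x#0 with #⇒<⊎> (inverse#0 x (trans (*-comm x _) (reciprocal x#0)))
    ... | inj₂ 0<y = _ , 0<y , reciprocal x#0
    -- Multiplying a negative inverse by `x` would give `1# < 0#`.
    ... | inj₁ y<0 = contradiction
      (<-trans (<-resp-≈ (trans (*-comm x _) (reciprocal x#0)) (zeroʳ x) (*-monoʳ-< 0<x y<0)) 0<1)
      <-irrefl

    *-cancelˡ-< : ∀ {z x y} → 0# < z → z * x < z * y → x < y
    *-cancelˡ-< {z} {x} {y} 0<z zx<zy with positive-inverse 0<z
    ... | w , 0<w , wz≈1 = <-resp-≈ (cancel x) (cancel y) (*-monoʳ-< 0<w zx<zy)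
      where
      cancel : ∀ u → w * (z * u) ≈ u
      cancel u = trans (sym (*-assoc w z u)) (trans (*-congʳ wz≈1) (*-identityˡ u))

    positive-bound : ∀ x → ∃[ m ] 0# < m × x < m
    positive-bound x with archimedean x
    ... | n , x<n = suc n ⋆ 1# , 0<1+ n , <-trans x<n (<-resp-≈ (+-identityˡ _) refl (+-monoˡ-< _ 0<1))
      where
      0<1+ : ∀ n → 0# < suc n ⋆ 1#
      0<1+ zero    = <-resp-≈ refl (sym (+-identityʳ 1#)) 0<1
      0<1+ (suc n) = <-resp-≈ (+-identityˡ 0#) refl (+-mono-< 0<1 (0<1+ n))

    -- `_<_` need not be decidable, so a sum of two positive bounds stands in for a maximum.
    common-bound : ∀ x y → ∃[ z ] x < z × y < z
    common-bound x y with positive-bound x | positive-bound y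
    ... | a , 0<a , x<a | b , 0<b , y<b =
      a + b , <-resp-≈ (+-identityʳ x) refl (+-mono-< x<a 0<b)
            , <-resp-≈ (+-identityˡ y) refl (+-mono-< 0<a y<b)

    x+z<y⇒x<y-z : ∀ {x y z} → x + z < y → x < y - z
    x+z<y⇒x<y-z {x} {y} {z} x+z<y =
      <-resp-≈ (solve 2 (λ x z → x :+ z :- z := x) refl x z) refl (+-monoˡ-< (- z) x+z<y)

    +-cancelʳ-< : ∀ {x y z} → x + z < y + z → x < y
    +-cancelʳ-< {x} {y} {z} x+z<y+z =
      <-resp-≈ refl (solve 2 (λ y z → y :+ z :- z := y) refl y z) (x+z<y⇒x<y-z x+z<y+z)

    -- Writing c = a - (a - c) as a difference of positive numbers avoids
    -- deciding its sign.
    linear-< : ∀ {a c δ x x′ y y′} → 0# < a → c < a →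
               x < x′ + δ → y < y′ + δ → y′ < y + δ →
               x + c * y < (x′ + c * y′) + δ * (1# + a + (a - c))
    linear-< {a} {c} {δ} {x} {x′} {y} {y′} 0<a c<a x< y< y′< = 0<y-x⇒x<y (<-resp-≈
      (trans (+-identityʳ _) (+-identityʳ _))
      (solve 7 (λ a c δ x x′ y y′ →
          (x′ :+ δ :- x) :+ a :* (y′ :+ δ :- y) :+ (a :- c) :* (y :+ δ :- y′)
          := ((x′ :+ c :* y′) :+ δ :* (con (+ 1) :+ a :+ (a :- c))) :- (x :+ c :* y))
        refl a c δ x x′ y y′
        ⟨ trans ⟩ +-congʳ (+-congˡ (*-congˡ (+-congʳ (+-congʳ (+-identityʳ 1#))))))
      (+-mono-< (+-mono-< (x<y⇒0<y-x x<) (*-pos 0<a (x<y⇒0<y-x y<)))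
                (*-pos (x<y⇒0<y-x c<a) (x<y⇒0<y-x y′<))))

    -- The value of the limit of `l * (B′ * S - C * f)` when `B′ * S` tends to `l * C` and `f` to
    -- `l`.
    proportional-cancel : ∀ l C → 0# + l * (l * C + - C * l) ≈ 0#
    proportional-cancel = solve 2 (λ l C → con (+ 0) :+ l :* (l :* C :+ (:- C) :* l) := con (+ 0)) refl

    halve : ∀ {x} → 0# < x → ∃[ y ] 0# < y × y + y ≈ x
    halve {x} 0<x with positive-inverse (<-resp-≈ (+-identityˡ 0#) refl (+-mono-< 0<1 0<1))
    ... | w , 0<w , w2≈1 = x * w , *-pos 0<x 0<w , (begin
      x * w + x * w              ≈⟨ +-cong (*-identityʳ _) (*-identityʳ _) ⟨
      x * w * 1# + x * w * 1#    ≈⟨ distribˡ _ 1# 1# ⟨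
      x * w * (1# + 1#)          ≈⟨ *-assoc _ _ _ ⟩
      x * (w * (1# + 1#))        ≈⟨ *-congˡ w2≈1 ⟩
      x * 1#                     ≈⟨ *-identityʳ x ⟩
      x                          ∎)
      where open ≈-Reasoning setoid

    -- Only the product `l * f` is known to be positive, so the inverse of `T` is assembled from an
    -- inverse `w` of that product, from `l` and from `B′`.
    factor#0 : ∀ {B B′ f l T} → B * B′ ≈ 1# → T ≈ B * f → 0# < l * f → T # 0#
    factor#0 {B} {B′} {f} {l} {T} BB′≈1 T≈Bf 0<lf with positive-inverse 0<lf
    ... | w , _ , w[lf]≈1 = inverse#0 (w * l * B′) (begin
      w * l * B′ * T             ≈⟨ *-congˡ T≈Bf ⟩
      w * l * B′ * (B * f)       ≈⟨ solve 5 (λ w l b B f → w :* l :* b :* (B :* f)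
                                      := B :* b :* (w :* (l :* f))) refl w l B′ B f ⟩
      B * B′ * (w * (l * f))     ≈⟨ *-cong BB′≈1 w[lf]≈1 ⟩
      1# * 1#                    ≈⟨ *-identityˡ 1# ⟩
      1#                         ∎)
      where open ≈-Reasoning setoid

    -- Multiplying the difference S / T - C by l f > 0 gives l (B′ S - C f), which
    -- avoids distinguishing the signs of l and f.
    quotient-near : ∀ {B B′ f l S T T⁻¹ C ε η} → B * B′ ≈ 1# → T ≈ B * f → T⁻¹ * T ≈ 1# →
      0# < ε → 0# < η → η < l * f → ∣ l * (B′ * S - C * f) - 0# ∣< (ε * η) →
      ∣ S * T⁻¹ - C ∣< ε
    quotient-near {B} {B′} {f} {l} {S} {T} {T⁻¹} {C} {ε} {η} BB′≈1 T≈Bf T⁻¹T≈1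
      0<ε 0<η η<lf (u<εη , 0<u+εη) =
      -- Adding the slack `ε * (l * f - η)` enlarges the tolerance `ε * η` to `ε * (l * f)`, after
      -- which the positive factor `l * f` cancels.
      *-cancelˡ-< 0<lf (0<y-x⇒x<y (<-resp-≈ (+-identityˡ 0#) upper
        (+-mono-< (x<y⇒0<y-x u<εη) (*-pos 0<ε (x<y⇒0<y-x η<lf))))) ,
      *-cancelˡ-< 0<lf (0<y-x⇒x<y (<-resp-≈ (+-identityˡ 0#) lower
        (+-mono-< 0<u+εη (*-pos 0<ε (x<y⇒0<y-x η<lf)))))
      where
      open ≈-Reasoning setoid

      0<lf : 0# < l * f
      0<lf = <-trans 0<η η<lf

      fT⁻¹≈B′ : f * T⁻¹ ≈ B′
      fT⁻¹≈B′ = begin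
        f * T⁻¹                   ≈⟨ *-identityˡ _ ⟨
        1# * (f * T⁻¹)            ≈⟨ *-congʳ BB′≈1 ⟨
        B * B′ * (f * T⁻¹)        ≈⟨ solve 4 (λ B b f i → B :* b :* (f :* i) := b :* (i :* (B :* f)))
                                       refl B B′ f T⁻¹ ⟩
        B′ * (T⁻¹ * (B * f))      ≈⟨ *-congˡ (*-congˡ T≈Bf) ⟨
        B′ * (T⁻¹ * T)            ≈⟨ *-congˡ T⁻¹T≈1 ⟩
        B′ * 1#                   ≈⟨ *-identityʳ B′ ⟩
        B′                        ∎

      lfST⁻¹≈lB′S : l * f * (S * T⁻¹) ≈ l * (B′ * S)
      lfST⁻¹≈lB′S = begin
        l * f * (S * T⁻¹)         ≈⟨ solve 4 (λ l f s i → l :* f :* (s :* i) := l :* (f :* i :* s))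
                                       refl l f S T⁻¹ ⟩
        l * (f * T⁻¹ * S)         ≈⟨ *-congˡ (*-congʳ fT⁻¹≈B′) ⟩
        l * (B′ * S)              ∎

      upper : (0# + ε * η - l * (B′ * S - C * f)) + ε * (l * f - η)
              ≈ l * f * (C + ε) - l * f * (S * T⁻¹)
      upper = begin
        (0# + ε * η - l * (B′ * S - C * f)) + ε * (l * f - η)
          ≈⟨ solve 6 (λ ε η l s C f →
               (con (+ 0) :+ ε :* η :- l :* (s :- C :* f)) :+ ε :* (l :* f :- η)
               := l :* f :* (C :+ ε) :- l :* s) refl ε η l (B′ * S) C f ⟩
        l * f * (C + ε) - l * (B′ * S)
          ≈⟨ +-congˡ (-‿cong lfST⁻¹≈lB′S) ⟨
        l * f * (C + ε) - l * f * (S * T⁻¹) ∎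

      lower : (l * (B′ * S - C * f) + ε * η) + ε * (l * f - η)
              ≈ l * f * (S * T⁻¹ + ε) - l * f * C
      lower = begin
        (l * (B′ * S - C * f) + ε * η) + ε * (l * f - η)
          ≈⟨ solve 6 (λ ε η l s C f →
               (l :* (s :- C :* f) :+ ε :* η) :+ ε :* (l :* f :- η)
               := (l :* s :+ l :* f :* ε) :- l :* f :* C) refl ε η l (B′ * S) C f ⟩
        (l * (B′ * S) + l * f * ε) - l * f * C
          ≈⟨ +-congʳ (+-congʳ lfST⁻¹≈lB′S) ⟨
        (l * f * (S * T⁻¹) + l * f * ε) - l * f * C
          ≈⟨ +-congʳ (distribˡ (l * f) _ _) ⟨
        l * f * (S * T⁻¹ + ε) - l * f * C ∎

-- Finite words and their rotations.

private variable
  a : Level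
  X : Set a

lookup-injective : {xs : List X} → Unique xs →
                   ∀ i j → lookup xs i ≡ lookup xs j → i ≡ j
lookup-injective (_  ∷ _)   zero    zero    _  = ≡.refl
lookup-injective (x∉ ∷ _)   zero    (suc j) eq = ⊥-elim (All.lookup x∉ (∈-lookup j) eq)
lookup-injective (x∉ ∷ _)   (suc i) zero    eq = ⊥-elim (All.lookup x∉ (∈-lookup i) (≡.sym eq))
lookup-injective (_  ∷ xs!) (suc i) (suc j) eq = ≡.cong suc (lookup-injective xs! i j eq)

-- Pigeonhole: the positions of a repetition-free list inject into `Fin n`. This bounds the length
-- of a simple cycle by the order of the graph.
Unique⇒length≤ : ∀ {n} {xs : List (Fin n)} → Unique xs → length xs ≤ℕ n
Unique⇒length≤ xs! = Fin.injective⇒≤ (lookup-injective xs! _ _)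

words : (n k : ℕ) → List (List (Fin n))
words n zero    = [ [] ]
-- Keeping `[]` at every level yields all words of length at most `k`, not only those of length
-- exactly `k`.
words n (suc k) = [] ∷ cartesianProductWith _∷_ (allFin n) (words n k)

words-complete : ∀ {n k} (xs : List (Fin n)) → length xs ≤ℕ k → xs ∈ words n k
words-complete {k = zero}  []       _          = here ≡.refl
words-complete {k = suc _} []       _          = here ≡.refl
words-complete {k = suc k} (x ∷ xs) (s≤s xs≤k) =
  there (∈-cartesianProductWith⁺ _∷_ (∈-allFin x) (words-complete xs xs≤k))

-- On vertex lists this unfolds to the same type as `_~_`, so results about words apply to cycles
-- directly.
Rotation : List X → List X → Set _
Rotation vs ws = ∃₂ λ xs ys → (vs ≡ xs ++ ys) × (ws ≡ ys ++ xs)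

Rotation-refl : (vs : List X) → Rotation vs vs
Rotation-refl vs = [] , vs , ≡.refl , ≡.sym (List.++-identityʳ vs)

-- Levi's lemma: `zs` is the piece between the two cuts of the same word.
++-split : (as bs xs ys : List X) → as ++ bs ≡ xs ++ ys →
           (∃[ zs ] (xs ≡ as ++ zs) × (bs ≡ zs ++ ys)) ⊎
           (∃[ zs ] (as ≡ xs ++ zs) × (ys ≡ zs ++ bs))
++-split []       bs xs       ys eq = inj₁ (xs , ≡.refl , eq)
++-split (a ∷ as) bs []       ys eq = inj₂ (a ∷ as , ≡.refl , ≡.sym eq)
++-split (a ∷ as) bs (x ∷ xs) ys eq with List.∷-injective eq
... | ≡.refl , eq′ with ++-split as bs xs ys eq′
... | inj₁ (zs , ≡.refl , e) = inj₁ (zs , ≡.refl , e)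
... | inj₂ (zs , ≡.refl , e) = inj₂ (zs , ≡.refl , e)

Rotation-trans : {us vs ws : List X} → Rotation us vs → Rotation vs ws → Rotation us ws
Rotation-trans (xs , ys , ≡.refl , e) (xs′ , ys′ , e′ , ≡.refl)
  with ++-split ys xs xs′ ys′ (≡.trans (≡.sym e) e′)
-- The two rotations together make at least a full turn; `zs` is what they exceed it by.
... | inj₁ (zs , ≡.refl , ≡.refl) =
  zs , ys′ ++ ys , List.++-assoc zs ys′ ys , ≡.sym (List.++-assoc ys′ ys zs)
... | inj₂ (zs , ≡.refl , ≡.refl) =
  xs ++ xs′ , zs , ≡.sym (List.++-assoc xs xs′ zs) , List.++-assoc zs xs xs′

rotation? : {X : Set a} → (∀ (x y : X) → Dec (x ≡ y)) →
            (vs ws : List X) → Dec (Rotation vs ws)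
rotation? _≟_ vs ws = map′ to from
  -- A rotation is determined by its cut. The `suc` makes the bound inclusive, since `from` may
  -- return the cut after the last letter.
  (ℕ.anyUpTo? (λ n → List.≡-dec _≟_ ws (drop n vs ++ take n vs)) (suc (length vs)))
  where
  to : (∃[ n ] _ × ws ≡ drop n vs ++ take n vs) → Rotation vs ws
  to (n , _ , eq) = take n vs , drop n vs , ≡.sym (List.take++drop≡id n vs) , eq

  rotate : (xs ys : List _) → drop (length xs) (xs ++ ys) ++ take (length xs) (xs ++ ys) ≡ ys ++ xs
  rotate xs ys = ≡.cong₂ _++_ (drop-length xs) (take-length xs)
    where
    drop-length : ∀ xs → drop (length xs) (xs ++ ys) ≡ ys
    drop-length []       = ≡.refl
    drop-length (_ ∷ xs) = drop-length xs
    take-length : ∀ xs → take (length xs) (xs ++ ys) ≡ xs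
    take-length []       = ≡.refl
    take-length (x ∷ xs) = ≡.cong (x ∷_) (take-length xs)

  from : Rotation vs ws → ∃[ n ] _ × ws ≡ drop n vs ++ take n vs
  from (xs , ys , ≡.refl , ≡.refl) =
    length xs ,
    s≤s (≡.subst (length xs ≤ℕ_) (≡.sym (List.length-++ xs)) (ℕ.m≤m+n _ _)) ,
    ≡.sym (rotate xs ys)

-- Repetition-free lists with the same elements.

module _ {c ℓ} (S : Setoid c ℓ) where

  open Setoid S
  open SetoidMembership S using () renaming (_∈_ to _∈′_)
  open SetoidPermutation S
  open SetoidUnique S using () renaming (Unique to Unique′)

  -- This makes a total independent of the chosen representatives. Deleting the counterpart of `x`
  -- from `ys` leaves lists with equal elements again, because uniqueness excludes a second copy on
  -- either side.
  Unique-⊆⇒↭ : ∀ {xs ys} → Unique′ xs → Unique′ ys →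
                    (∀ {z} → z ∈′ xs → z ∈′ ys) → (∀ {z} → z ∈′ ys → z ∈′ xs) → xs ↭ ys
  Unique-⊆⇒↭ {[]} {[]}     _ _ _ _ = ↭-refl
  Unique-⊆⇒↭ {[]} {y ∷ ys} _ _ _ ys⊆ = case ys⊆ (here (Setoid.refl S)) of λ ()
  Unique-⊆⇒↭ {x ∷ xs} {ys} (x∉xs ∷ xs!) ys! ⊆ys ys⊆
    with ∈ₚ.∈-∃++ S (⊆ys (here (Setoid.refl S)))
  ... | as , bs , w , x≈w , ys≋ = ↭-trans (↭-prep x xs↭) (↭-sym ys↭)
    where
    ys↭ : ys ↭ x ∷ as ++ bs
    ys↭ = ↭-trans (↭-reflexive-≋ ys≋) (↭ₚ.shift S (Setoid.sym S x≈w) as bs)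
    outside : ∀ {z zs} → All (λ v → ¬ (x ≈ v)) zs → z ∈′ zs → ¬ (z ≈ x)
    outside (x≉v ∷ _) (here z≈v) z≈x = x≉v (Setoid.trans S (Setoid.sym S z≈x) z≈v)
    outside (_ ∷ x∉)  (there z∈) z≈x = outside x∉ z∈ z≈x
    tail : ∀ {z zs} → ¬ (z ≈ x) → z ∈′ (x ∷ zs) → z ∈′ zs
    tail z≉x (here z≈x) = contradiction z≈x z≉x
    tail z≉x (there z∈) = z∈
    xs↭ : xs ↭ as ++ bs
    xs↭ with ↭ₚ.Unique-resp-↭ S ys↭ ys!
    ... | x∉asbs ∷ asbs! = Unique-⊆⇒↭ xs! asbs!
      (λ z∈ → tail (outside x∉xs z∈) (↭ₚ.∈-resp-↭ S ys↭ (⊆ys (there z∈))))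
      (λ z∈ → tail (outside x∉asbs z∈) (ys⊆ (↭ₚ.∈-resp-↭ S (↭-sym ys↭) (there z∈))))

-- Simple cycles up to rotation, and hikes as a trace monoid.

module HikeProperties {c ℓ₁ ℓ₂ : Level} (R : RealField c ℓ₁ ℓ₂) (G : WeightedDigraph R) where

  open RealField R hiding (_<_)
  open WeightedDigraph G
  open Hikes R G
  open Cycle using (vertices)

  ~-refl : ∀ {p} → p ~ p
  ~-refl {p} = Rotation-refl (vertices p)

  ~-sym : ∀ {p q} → p ~ q → q ~ p
  ~-sym (xs , ys , e , e′) = ys , xs , e′ , e

  ~-trans : ∀ {p q r} → p ~ q → q ~ r → p ~ r
  ~-trans = Rotation-trans

  _~?_ : ∀ p q → Dec (p ~ q)
  p ~? q = rotation? Fin._≟_ (vertices p) (vertices q)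

  cycleDecSetoid : DecSetoid ℓ₂ _
  cycleDecSetoid = record
    { _≈_ = _~_
    ; isDecEquivalence = record
      { isEquivalence = record
        { refl  = λ {p} → ~-refl {p}
        ; sym   = λ {p} {q} → ~-sym {p} {q}
        ; trans = λ {p} {q} {r} → ~-trans {p} {q} {r} }
      ; _≟_ = _~?_ } }

  ~⇒∈ : ∀ {p q v} → p ~ q → v ∈ vertices p → v ∈ vertices q
  ~⇒∈ {v = v} (xs , ys , e , e′) v∈p with ∈-++⁻ xs (≡.subst (v ∈_) e v∈p)
  ... | inj₁ v∈xs = ≡.subst (v ∈_) (≡.sym e′) (∈-++⁺ʳ ys v∈xs)
  ... | inj₂ v∈ys = ≡.subst (v ∈_) (≡.sym e′) (∈-++⁺ˡ v∈ys)

  disjoint-sym : ∀ {p q} → VertexDisjoint p q → VertexDisjoint q p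
  disjoint-sym p⊥q (v∈q , v∈p) = p⊥q (v∈p , v∈q)

  disjoint-resp-~ : ∀ {p p′ q q′} → p ~ p′ → q ~ q′ → VertexDisjoint p q → VertexDisjoint p′ q′
  disjoint-resp-~ {p} {p′} {q} {q′} p~p′ q~q′ p⊥q (v∈p′ , v∈q′) =
    p⊥q (~⇒∈ {p′} {p} (~-sym {p} {p′} p~p′) v∈p′ , ~⇒∈ {q′} {q} (~-sym {q} {q′} q~q′) v∈q′)

  -- A cycle has a starting vertex, and every rotation of the cycle contains it.
  disjoint⇒≁ : ∀ {p q} → VertexDisjoint p q → ¬ (p ~ q)
  disjoint⇒≁ {p} {q} p⊥q p~q = p⊥q (here ≡.refl , ~⇒∈ {p} {q} p~q (here ≡.refl))

  disjointFrom? : ∀ p → Decidable (VertexDisjoint p)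
  disjointFrom? p q = disjoint? Fin._≟_ (vertices p) (vertices q)

  -- The trace monoid

  ≈ₕ-refl : ∀ {h} → h ≈ₕ h
  ≈ₕ-refl {[]}    = ≈-nil
  ≈ₕ-refl {p ∷ h} = ≈-cons (~-refl {p}) ≈ₕ-refl

  hikeSetoid : Setoid ℓ₂ ℓ₂
  hikeSetoid = record
    { _≈_ = _≈ₕ_
    ; isEquivalence = record { refl = ≈ₕ-refl ; sym = ≈-sym ; trans = ≈-trans } }

  ++-congʳ : ∀ {h k} l → h ≈ₕ k → h ++ l ≈ₕ k ++ l
  ++-congʳ l ≈-nil             = ≈ₕ-refl
  ++-congʳ l (≈-cons p~q h≈k)  = ≈-cons p~q (++-congʳ l h≈k)
  ++-congʳ l (≈-swap h p⊥q)    = ≈-swap (h ++ l) p⊥q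
  ++-congʳ l (≈-sym h≈k)       = ≈-sym (++-congʳ l h≈k)
  ++-congʳ l (≈-trans h≈k k≈m) = ≈-trans (++-congʳ l h≈k) (++-congʳ l k≈m)

  ∷≈∷ʳ : ∀ {p h} → All (VertexDisjoint p) h → p ∷ h ≈ₕ h ++ [ p ]
  ∷≈∷ʳ []            = ≈ₕ-refl
  ∷≈∷ʳ {p} {q ∷ h} (p⊥q ∷ p⊥h) = ≈-trans (≈-swap h p⊥q) (≈-cons (~-refl {q}) (∷≈∷ʳ p⊥h))

  -- Both directions are proved together because `≈-sym` is a constructor, at which the induction
  -- exchanges them.
  All-resp-≈ₕ : ∀ {ℓ} {P : Pred Cycle ℓ} → P Respects _~_ → ∀ {h k} → h ≈ₕ k →
                (All P h → All P k) × (All P k → All P h)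
  All-resp-≈ₕ resp ≈-nil = id , id
  All-resp-≈ₕ resp (≈-cons {p} {q} p~q h≈k) =
    (λ { (x ∷ xs) → resp p~q x ∷ proj₁ ih xs }) ,
    (λ { (x ∷ xs) → resp (~-sym {p} {q} p~q) x ∷ proj₂ ih xs })
    where ih = All-resp-≈ₕ resp h≈k
  All-resp-≈ₕ resp (≈-swap h p⊥q) =
    (λ { (x ∷ y ∷ xs) → y ∷ x ∷ xs }) , (λ { (x ∷ y ∷ xs) → y ∷ x ∷ xs })
  All-resp-≈ₕ resp (≈-sym h≈k) = swap (All-resp-≈ₕ resp h≈k)
  All-resp-≈ₕ resp (≈-trans h≈k k≈l) =
    proj₁ (All-resp-≈ₕ resp k≈l) ∘ proj₁ (All-resp-≈ₕ resp h≈k) ,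
    proj₂ (All-resp-≈ₕ resp h≈k) ∘ proj₂ (All-resp-≈ₕ resp k≈l)

  -- Removes p h k: deleting from the word h an occurrence of p which commutes
  -- with everything to its right leaves k.
  data Removes (p : Cycle) : Hike → Hike → Set ℓ₂ where
    here  : ∀ {q h} → p ~ q → All (VertexDisjoint p) h → Removes p (q ∷ h) h
    there : ∀ {q h k} → Removes p h k → Removes p (q ∷ h) (q ∷ k)

  Removes-∷ʳ : ∀ p h → Removes p (h ++ [ p ]) h
  Removes-∷ʳ p []      = here (~-refl {p}) []
  Removes-∷ʳ p (_ ∷ h) = there (Removes-∷ʳ p h)

  Removes⇒≈∷ʳ : ∀ {p h k} → Removes p h k → h ≈ₕ k ++ [ p ]
  Removes⇒≈∷ʳ {p} (here {q} p~q p⊥h) = ≈-trans (≈-cons (~-sym {p} {q} p~q) ≈ₕ-refl) (∷≈∷ʳ p⊥h)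
  Removes⇒≈∷ʳ (there {q} r)      = ≈-cons (~-refl {q}) (Removes⇒≈∷ʳ r)

  Removes-All : ∀ {ℓ} {P : Pred Cycle ℓ} {p h k} → Removes p h k → All P h → All P k
  Removes-All (here _ _)  (_ ∷ xs) = xs
  Removes-All (there r) (x ∷ xs) = x ∷ Removes-All r xs

  Removes-AllPairs : ∀ {ℓ} {P : Cycle → Cycle → Set ℓ} {p h k} →
                     Removes p h k → AllPairs P h → AllPairs P k
  Removes-AllPairs (here _ _) (_ ∷ xs) = xs
  Removes-AllPairs (there r) (x ∷ xs) = Removes-All r x ∷ Removes-AllPairs r xs

  Removes⇒∈ : ∀ {p h k} → Removes p h k → Any (p ~_) h
  Removes⇒∈ (here p~q _) = here p~q
  Removes⇒∈ (there r)    = there (Removes⇒∈ r)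

  disjoint⇒¬∈ : ∀ {p h} → All (VertexDisjoint p) h → ¬ Any (p ~_) h
  disjoint⇒¬∈ {p} {q ∷ _} (p⊥q ∷ _) (here p~q) = disjoint⇒≁ {p} {q} p⊥q p~q
  disjoint⇒¬∈ {p} (_ ∷ p⊥h) (there p∈h) = disjoint⇒¬∈ {p} p⊥h p∈h

  -- A cycle is not disjoint from its own rotations, so only the last occurrence of `p` can be moved
  -- to the right end.
  Removes-deterministic : ∀ {p h k l} → Removes p h k → Removes p h l → k ≡ l
  Removes-deterministic (here _ _)   (here _ _)   = ≡.refl
  Removes-deterministic {p} (here _ p⊥h) (there r)    = contradiction (Removes⇒∈ r) (disjoint⇒¬∈ {p} p⊥h)
  Removes-deterministic {p} (there r)    (here _ p⊥h) = contradiction (Removes⇒∈ r) (disjoint⇒¬∈ {p} p⊥h)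
  Removes-deterministic (there r)    (there s)    = ≡.cong (_ ∷_) (Removes-deterministic r s)

  Transfers : Hike → Hike → Set ℓ₂
  Transfers h k = ∀ {p h′} → Removes p h h′ → ∃[ k′ ] Removes p k k′ × h′ ≈ₕ k′

  transfers-cons : ∀ {p q h k} → p ~ q → h ≈ₕ k → Transfers h k → Transfers (p ∷ h) (q ∷ k)
  transfers-cons {p} {q} p~q h≈k t {r} (here r~p r⊥h) =
    _ , here (~-trans {r} {p} {q} r~p p~q) (proj₁ (All-resp-≈ₕ (λ {x} {y} → resp {x} {y}) h≈k) r⊥h) , h≈k
    where
    resp : VertexDisjoint r Respects _~_
    resp {x} {y} x~y = disjoint-resp-~ {r} {r} {x} {y} (~-refl {r}) x~y
  transfers-cons p~q h≈k t (there r) with t r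
  ... | k′ , s , h′≈k′ = _ , there s , ≈-cons p~q h′≈k′

  transfers-swap : ∀ {p q} h → VertexDisjoint p q → Transfers (p ∷ q ∷ h) (q ∷ p ∷ h)
  transfers-swap h p⊥q (here r~p (r⊥q ∷ r⊥h)) = _ , there (here r~p r⊥h) , ≈ₕ-refl
  -- The deleted letter is the `q` that the swap puts in front of `p`, so it must now commute with
  -- `p` as well.
  transfers-swap {p} {q} h p⊥q {r} (there (here r~q r⊥h)) =
    _ , here r~q (disjoint-resp-~ {q} {r} {p} {p} (~-sym {r} {q} r~q) (~-refl {p})
                    (disjoint-sym {p} {q} p⊥q) ∷ r⊥h) , ≈ₕ-refl
  transfers-swap h p⊥q (there (there {k = k} r)) = _ , there (there r) , ≈-swap k p⊥q

  -- Removal is defined on words; this carries it over to hikes, so that right divisibility by a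
  -- prime becomes a decidable condition on any one word.
  Removes-resp-≈ₕ : ∀ {h k} → h ≈ₕ k → Transfers h k × Transfers k h
  Removes-resp-≈ₕ ≈-nil = (λ ()) , (λ ())
  Removes-resp-≈ₕ (≈-cons {p} {q} p~q h≈k) =
    transfers-cons p~q h≈k (proj₁ (Removes-resp-≈ₕ h≈k)) ,
    transfers-cons (~-sym {p} {q} p~q) (≈-sym h≈k) (proj₂ (Removes-resp-≈ₕ h≈k))
  Removes-resp-≈ₕ (≈-swap {p} {q} h p⊥q) =
    transfers-swap h p⊥q , transfers-swap h (disjoint-sym {p} {q} p⊥q)
  Removes-resp-≈ₕ (≈-sym h≈k) = swap (Removes-resp-≈ₕ h≈k)
  Removes-resp-≈ₕ (≈-trans h≈k k≈l) =
    compose (proj₁ (Removes-resp-≈ₕ h≈k)) (proj₁ (Removes-resp-≈ₕ k≈l)) ,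
    compose (proj₂ (Removes-resp-≈ₕ k≈l)) (proj₂ (Removes-resp-≈ₕ h≈k))
    where
    compose : ∀ {h k l} → Transfers h k → Transfers k l → Transfers h l
    compose t u r with t r
    ... | _ , s , h′≈k′ with u s
    ... | _ , s′ , k′≈l′ = _ , s′ , ≈-trans h′≈k′ k′≈l′

  ≈∷ʳ⇒Removes : ∀ {p h k} → h ≈ₕ k ++ [ p ] → ∃[ h′ ] Removes p h h′ × k ≈ₕ h′
  ≈∷ʳ⇒Removes {p} {h} {k} h≈kp = proj₁ (Removes-resp-≈ₕ (≈-sym h≈kp)) (Removes-∷ʳ p k)

  -- The removal of the final `p` from `h ++ [ p ]` is transported along the derivation; on
  -- `k ++ [ p ]` determinism lets it leave only `k`.
  ∷ʳ-cancel : ∀ {p h k} → h ++ [ p ] ≈ₕ k ++ [ p ] → h ≈ₕ k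
  ∷ʳ-cancel {p} {h} {k} hp≈kp with ≈∷ʳ⇒Removes (≈-sym hp≈kp)
  ... | k′ , r , h≈k′ = ≡.subst (h ≈ₕ_) (Removes-deterministic r (Removes-∷ʳ p k)) h≈k′

  ∣ᵣ⇒Removes : ∀ {p h} → [ p ] ∣ᵣ h → ∃[ k ] Removes p h k
  ∣ᵣ⇒Removes (_ , h≈) with ≈∷ʳ⇒Removes h≈
  ... | h′ , r , _ = h′ , r

  Removes⇒∣ᵣ : ∀ {p h k} → Removes p h k → [ p ] ∣ᵣ h
  Removes⇒∣ᵣ r = _ , Removes⇒≈∷ʳ r

  removes? : ∀ p h → Dec (∃[ k ] Removes p h k)
  removes? p [] = no λ ()
  removes? p (q ∷ h) with removes? p h | p ~? q | All.all? (disjointFrom? p) h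
  ... | yes (k , r) | _       | _       = yes (q ∷ k , there r)
  ... | no _        | yes p~q | yes p⊥h = yes (h , here p~q p⊥h)
  ... | no ¬r       | no p≁q  | _       = no λ { (_ , here p~q _) → p≁q p~q ; (_ , there r) → ¬r (_ , r) }
  ... | no ¬r       | _       | no ¬p⊥h = no λ { (_ , here _ p⊥h) → ¬p⊥h p⊥h ; (_ , there r) → ¬r (_ , r) }

  divides? : ∀ p h → Dec ([ p ] ∣ᵣ h)
  divides? p h = map′ (λ (_ , r) → Removes⇒∣ᵣ r) ∣ᵣ⇒Removes (removes? p h)

  ∣ᵣ-resp-≈ₕ : ∀ {d h k} → h ≈ₕ k → d ∣ᵣ h → d ∣ᵣ k
  ∣ᵣ-resp-≈ₕ h≈k (h′ , h≈) = h′ , ≈-trans (≈-sym h≈k) h≈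

  ∣ᵣ-resp-~ : ∀ {p q h} → p ~ q → [ p ] ∣ᵣ h → [ q ] ∣ᵣ h
  ∣ᵣ-resp-~ {p} {q} {h} p~q p∣h with ∣ᵣ⇒Removes p∣h
  ... | _ , r = Removes⇒∣ᵣ (transport r)
    where
    transport : ∀ {h k} → Removes p h k → Removes q h k
    transport (here {r} {h} p~r p⊥h) = here (~-trans {q} {p} {r} (~-sym {p} {q} p~q) p~r)
      (All.map (λ {x} → disjoint-resp-~ {p} {q} {x} {x} p~q (~-refl {x})) p⊥h)
    transport (there r) = there (transport r)

  ∣ᵣ-∷ʳ⁺ : ∀ {p q h} → VertexDisjoint q p → [ q ] ∣ᵣ h → [ q ] ∣ᵣ h ++ [ p ]
  ∣ᵣ-∷ʳ⁺ {p} {q} q⊥p q∣h with ∣ᵣ⇒Removes q∣h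
  ... | _ , r = Removes⇒∣ᵣ (extend r)
    where
    extend : ∀ {h k} → Removes q h k → Removes q (h ++ [ p ]) (k ++ [ p ])
    extend (here q~x q⊥h) = here q~x (All.++⁺ q⊥h (q⊥p ∷ []))
    extend (there r) = there (extend r)

  -- The occurrence of `q` that is removed is not the final `p`, so it lies in `h` and has to
  -- commute past that `p`.
  ∣ᵣ-∷ʳ⁻ : ∀ {p q h} → ¬ (q ~ p) → [ q ] ∣ᵣ h ++ [ p ] → VertexDisjoint q p × [ q ] ∣ᵣ h
  ∣ᵣ-∷ʳ⁻ {p} {q} {h} q≁p q∣hp with ∣ᵣ⇒Removes q∣hp
  ... | _ , r with restrict h r
    where
    restrict : ∀ h {k} → Removes q (h ++ [ p ]) k → VertexDisjoint q p × ∃[ k′ ] Removes q h k′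
    restrict []      (here q~p _)  = contradiction q~p q≁p
    restrict []      (there ())
    restrict (_ ∷ h) (here q~x q⊥) with All.++⁻ h q⊥
    ... | q⊥h , (q⊥p ∷ []) = q⊥p , _ , here q~x q⊥h
    restrict (_ ∷ h) (there r) with restrict h r
    ... | q⊥p , _ , r′ = q⊥p , _ , there r′
  ... | q⊥p , _ , r′ = q⊥p , Removes⇒∣ᵣ r′

  -- All factors of a self-avoiding hike commute, so any of them can be brought to the right end.
  selfAvoiding-remove : ∀ {p h} → SelfAvoiding h → Any (p ~_) h →
                        ∃[ k ] Removes p h k × All (VertexDisjoint p) k
  selfAvoiding-remove {p} {q ∷ h} (q⊥h ∷ _) (here p~q) = h , here p~q p⊥h , p⊥h
    where p⊥h = All.map (λ {x} → disjoint-resp-~ {q} {p} {x} {x} (~-sym {p} {q} p~q) (~-refl {x})) q⊥h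
  selfAvoiding-remove {p} {q ∷ h} (q⊥h ∷ h!) (there p∈h) with selfAvoiding-remove h! p∈h
  ... | k , r , p⊥k = q ∷ k , there r , p⊥q q⊥h p∈h ∷ p⊥k
    where
    p⊥q : ∀ {h} → All (VertexDisjoint q) h → Any (p ~_) h → VertexDisjoint p q
    p⊥q {x ∷ _} (q⊥x ∷ _) (here p~x) =
      disjoint-resp-~ {x} {p} {q} {q} (~-sym {p} {x} p~x) (~-refl {q}) (disjoint-sym {q} {x} q⊥x)
    p⊥q (_ ∷ q⊥h) (there p∈h) = p⊥q q⊥h p∈h

  -- Weights

  private module CR = CommutativeRing commutativeRing

  product : List (Vertex × Vertex) → Carrier
  product es = foldr _*_ 1# (map (uncurry A) es)

  product-++ : ∀ es fs → product (es ++ fs) ≈ product es * product fs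
  product-++ []       fs = sym (*-identityˡ _)
  product-++ (e ∷ es) fs = trans (*-congˡ (product-++ es fs)) (sym (*-assoc _ _ _))

  -- `arcs` of a cycle is the case of equal endpoints. Open walks are needed because two starting
  -- points cut a cycle into two of them, which a rotation exchanges.
  walk : Vertex → List Vertex → Vertex → List (Vertex × Vertex)
  walk u vs w = zip (u ∷ vs) (vs ++ [ w ])

  walk-++ : ∀ u us v vs w → walk u (us ++ v ∷ vs) w ≡ walk u us v ++ walk v vs w
  walk-++ u []        v vs w = ≡.refl
  walk-++ u (u′ ∷ us) v vs w = ≡.cong ((u , u′) ∷_) (walk-++ u′ us v vs w)

  weightᶜ-resp-~ : ∀ {p q} → p ~ q → weightᶜ p ≈ weightᶜ q
  weightᶜ-resp-~ {p} {q} (xs , ys , e , e′) =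
    rotate (Cycle.start p) (Cycle.rest p) (Cycle.start q) (Cycle.rest q) xs ys e e′
    where
    rotate : ∀ s r s′ r′ xs ys → s ∷ r ≡ xs ++ ys → s′ ∷ r′ ≡ ys ++ xs →
             product (walk s r s) ≈ product (walk s′ r′ s′)
    rotate s r s′ r′ [] ys ≡.refl e′ with ≡.trans e′ (List.++-identityʳ ys)
    ... | ≡.refl = refl
    rotate s r s′ r′ (x ∷ xs) [] e ≡.refl with ≡.trans e (List.++-identityʳ (x ∷ xs))
    ... | ≡.refl = refl
    rotate s r s′ r′ (x ∷ xs) (y ∷ ys) ≡.refl ≡.refl = begin
      product (walk x (xs ++ y ∷ ys) x)                ≡⟨ ≡.cong product (walk-++ x xs y ys x) ⟩
      product (walk x xs y ++ walk y ys x)             ≈⟨ product-++ (walk x xs y) _ ⟩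
      product (walk x xs y) * product (walk y ys x)    ≈⟨ *-comm _ _ ⟩
      product (walk y ys x) * product (walk x xs y)    ≈⟨ product-++ (walk y ys x) _ ⟨
      product (walk y ys x ++ walk x xs y)             ≡⟨ ≡.cong product (walk-++ y ys x xs y) ⟨
      product (walk y (ys ++ x ∷ xs) y)                ∎
      where open ≈-Reasoning setoid

  weight-resp-≈ₕ : ∀ {h k} → h ≈ₕ k → weight h ≈ weight k
  weight-resp-≈ₕ ≈-nil = refl
  weight-resp-≈ₕ (≈-cons {p} {q} p~q h≈k) = *-cong (weightᶜ-resp-~ {p} {q} p~q) (weight-resp-≈ₕ h≈k)
  weight-resp-≈ₕ (≈-swap h _) =
    trans (sym (*-assoc _ _ _)) (trans (*-congʳ (*-comm _ _)) (*-assoc _ _ _))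
  weight-resp-≈ₕ (≈-sym h≈k) = sym (weight-resp-≈ₕ h≈k)
  weight-resp-≈ₕ (≈-trans h≈k k≈l) = trans (weight-resp-≈ₕ h≈k) (weight-resp-≈ₕ k≈l)

  weight-∷ʳ : ∀ h p → weight (h ++ [ p ]) ≈ weight h * weightᶜ p
  weight-∷ʳ []      p = *-comm _ _
  weight-∷ʳ (q ∷ h) p = trans (*-congˡ (weight-∷ʳ h p)) (sym (*-assoc _ _ _))

  μ-selfAvoiding : ∀ {h} → SelfAvoiding h → μ h ≡ (- 1#) ^ length h
  μ-selfAvoiding {h} h! rewrite dec-true (selfAvoiding? h) h! = ≡.refl

  -- Totals

  total : (Hike → Carrier) → List Hike → Carrier
  total g hs = foldr _+_ 0# (map g hs)

  total-++ : ∀ g hs ks → total g (hs ++ ks) ≈ total g hs + total g ks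
  total-++ g []       ks = sym (+-identityˡ _)
  total-++ g (h ∷ hs) ks = trans (+-congˡ (total-++ g hs ks)) (sym (+-assoc _ _ _))

  -- This turns two enumerations of the same hikes into an equation between sums.
  HasTotal-functional : ∀ {ℓ} {P : Pred Hike ℓ} {g s s′} → (∀ {h k} → h ≈ₕ k → g h ≈ g k) →
                        HasTotal P g s → HasTotal P g s′ → s ≈ s′
  HasTotal-functional {P = P} {g} g-cong (hs , P-hs , hs-all , hs! , s≈) (ks , P-ks , ks-all , ks! , s′≈) =
    trans s≈ (trans hs≈ks (sym s′≈))
    where
    member : ∀ {xs} → All P xs → ∀ {h} → Any (h ≈ₕ_) xs → ∃[ k ] P k × h ≈ₕ k
    member (Pk ∷ _)  (here h≈k)  = _ , Pk , h≈k
    member (_ ∷ Pxs) (there h∈) = member Pxs h∈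
    inclusion : ∀ {xs ys} → All P xs → (∀ h → P h → Any (h ≈ₕ_) ys) →
                ∀ {h} → Any (h ≈ₕ_) xs → Any (h ≈ₕ_) ys
    inclusion Pxs all-ys h∈ with member Pxs h∈
    ... | k , Pk , h≈k = Any.map (≈-trans h≈k) (all-ys k Pk)
    hs≈ks : total g hs ≈ total g ks
    hs≈ks = ↭ₚ.foldr-commMonoid setoid CR.+-isCommutativeMonoid
      (↭ₚ.map⁺ hikeSetoid setoid g-cong
        (Unique-⊆⇒↭ hikeSetoid hs! ks! (inclusion P-hs ks-all) (inclusion P-ks hs-all)))

  HasTotal-resp : ∀ {ℓ ℓ′} {P : Pred Hike ℓ} {Q : Pred Hike ℓ′} {g s} →
                  (∀ {h} → P h → Q h) → (∀ {h} → Q h → P h) → HasTotal P g s → HasTotal Q g s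
  HasTotal-resp P⊆Q Q⊆P (hs , P-hs , all , hs! , s≈) =
    hs , All.map P⊆Q P-hs , (λ h Qh → all h (Q⊆P Qh)) , hs! , s≈

  HasTotal-filter : ∀ {ℓ ℓ′} {P : Pred Hike ℓ} {Q : Pred Hike ℓ′} {g s} → Decidable Q →
                    (∀ {h k} → h ≈ₕ k → Q h → Q k) → HasTotal P g s →
                    ∃[ s′ ] HasTotal (λ h → P h × Q h) g s′
  HasTotal-filter Q? Q-resp (hs , P-hs , all , hs! , _) =
    _ , filter Q? hs ,
    All.zip (All.filter⁺ Q? P-hs , All.all-filter Q? hs) ,
    (λ h (Ph , Qh) → ∈ₚ.∈-filter⁺ hikeSetoid Q? Q-resp (all h Ph) Qh) ,
    AllPairs.filter⁺ Q? hs! , refl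

  -- The recursions for `T` and for `C` are both instances. `P₁` is the part of `P` not divisible by
  -- `p`; the rest are the hikes `k ++ [ p ]` with `k` in `P₂`, where the final `p` contributes the
  -- factor `a`.
  HasTotal-split : ∀ {ℓ ℓ′ ℓ″} {P : Pred Hike ℓ} {P₁ : Pred Hike ℓ′} {P₂ : Pred Hike ℓ″}
    {g g′ s₁ s₂ a} (p : Cycle) →
    (∀ {h} → P₁ h → P h) → (∀ {h} → P₂ h → P (h ++ [ p ])) →
    (∀ {h} → P₁ h → ¬ ([ p ] ∣ᵣ h)) →
    (∀ {h} → P h → P₁ h ⊎ ∃[ k ] h ≈ₕ k ++ [ p ] × P₂ k) →
    (∀ {h} → P₂ h → g (h ++ [ p ]) ≈ a * g′ h) →
    HasTotal P₁ g s₁ → HasTotal P₂ g′ s₂ → HasTotal P g (s₁ + a * s₂)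
  HasTotal-split {P₂ = P₂} {g} {g′} {a = a} p P₁⊆P P₂⊆P P₁⊆∤ split g-∷ʳ
    (hs , P₁-hs , hs-all , hs! , s₁≈) (ks , P₂-ks , ks-all , ks! , s₂≈) =
    hs ++ map (_++ [ p ]) ks ,
    All.++⁺ (All.map P₁⊆P P₁-hs) (All.map⁺ (All.map P₂⊆P P₂-ks)) ,
    (λ h Ph → covered (split Ph)) ,
    -- Cancelling the final `p` shows that the second list has no repetitions; divisibility by `p`
    -- separates it from the first.
    AllPairs.++⁺ hs! (AllPairs.map⁺ (AllPairs.map (_∘ ∷ʳ-cancel) ks!))
      (All.map (λ P₁h → All.map⁺ (All.universal (λ k h≈kp → P₁⊆∤ P₁h (k , h≈kp)) ks)) P₁-hs) ,
    (begin
      _                                                  ≈⟨ +-cong s₁≈ (*-congˡ s₂≈) ⟩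
      total g hs + a * total g′ ks                       ≈⟨ +-congˡ (scale P₂-ks) ⟨
      total g hs + total g (map (_++ [ p ]) ks)          ≈⟨ total-++ g hs _ ⟨
      total g (hs ++ map (_++ [ p ]) ks)                 ∎)
    where
    open ≈-Reasoning setoid
    covered : ∀ {h} → _ ⊎ _ → Any (h ≈ₕ_) (hs ++ map (_++ [ p ]) ks)
    covered (inj₁ P₁h) = Any.++⁺ˡ (hs-all _ P₁h)
    covered (inj₂ (k , h≈kp , P₂k)) = Any.++⁺ʳ hs
      (Any.map⁺ (Any.map (λ k≈ → ≈-trans h≈kp (++-congʳ [ p ] k≈)) (ks-all k P₂k)))
    scale : ∀ {ks} → All P₂ ks → total g (map (_++ [ p ]) ks) ≈ a * total g′ ks
    scale []           = sym (zeroʳ a)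
    scale (P₂k ∷ P₂ks) = trans (+-cong (g-∷ʳ P₂k) (scale P₂ks)) (sym (distribˡ a _ _))

  -- Enumeration of the primes

  arcDec : ∀ i j → Dec (Arc i j)
  arcDec i j with arc? i j
  ... | inj₁ ≈0 = no (#-irrefl ≈0)
  ... | inj₂ #0 = yes #0

  cycle? : ∀ vs → Dec (∃[ p ] vertices p ≡ vs)
  cycle? [] = no λ ()
  cycle? (v ∷ vs) = map′
    (λ (d , c) → record { start = v ; rest = vs ; distinct = d ; closed = c } , ≡.refl)
    (λ { (p , ≡.refl) → Cycle.distinct p , Cycle.closed p })
    (DecUnique.unique? Fin._≟_ (v ∷ vs) ×-dec All.all? (uncurry arcDec) (walk v vs v))

  -- Cycles with the same vertices may carry different proofs that their arcs exist, so completeness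
  -- is meant up to `_~_`.
  realise : ∀ vss → ∃[ L ] (∀ p → vertices p ∈ vss → Any (p ~_) L)
  realise [] = [] , λ _ ()
  realise (vs ∷ vss) with realise vss | cycle? vs
  ... | L , all | no ¬c = L , λ { p (here eq) → contradiction (p , eq) ¬c ; p (there e) → all p e }
  ... | L , all | yes (q , ≡.refl) = q ∷ L , λ
    { p (here eq) → here (≡.subst (Rotation (vertices p)) eq (Rotation-refl (vertices p)))
    ; p (there e) → there (all p e) }

  cycles : ∃[ L ] (∀ p → Any (p ~_) L)
  cycles with realise (words order order)
  ... | L , all = L , λ p → all p (words-complete (vertices p) (Unique⇒length≤ (Cycle.distinct p)))

  IsPrimeOn-resp-~ : ∀ H {p q} → p ~ q → IsPrimeOn H p → IsPrimeOn H q
  IsPrimeOn-resp-~ H {p} {q} p~q p⊆H =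
    All.tabulate (λ v∈q → All.lookup p⊆H (~⇒∈ {q} {p} (~-sym {p} {q} p~q) v∈q))

  Distinct : List Cycle → Set _
  Distinct = AllPairs (λ p q → ¬ (p ~ q))

  -- One representative per rotation class is kept because the recursion needs the head of the list
  -- to be inequivalent to every later prime.
  primesOn : ∀ H → ∃[ L ] Distinct L × All (IsPrimeOn H) L × (∀ p → IsPrimeOn H p → Any (p ~_) L)
  primesOn H with cycles
  ... | L , all =
    deduplicate _~?_ (filter primeOn? L) ,
    deduplicate-! cycleDecSetoid (filter primeOn? L) ,
    All.deduplicate⁺ _~?_ (All.all-filter primeOn? L) ,
    λ p p⊆H → Any.deduplicate⁺ _~?_ {P = p ~_}
      (λ {x} {y} y~x p~x → ~-trans {p} {x} {y} p~x (~-sym {y} {x} y~x))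
      (∈ₚ.∈-filter⁺ (DecSetoid.setoid cycleDecSetoid) {P = IsPrimeOn H} primeOn?
        (λ {x} {y} → IsPrimeOn-resp-~ H {x} {y}) {v = p} (all p) p⊆H)
    where
    primeOn? : Decidable (IsPrimeOn H)
    primeOn? p = All.all? (_∈? H) (vertices p)

-- Limits along the ranks.

module RankProperties {c ℓ₁ ℓ₂ : Level} (R : RealField c ℓ₁ ℓ₂) (G : WeightedDigraph R)
  (ρ : Hikes.RankFunction R G) where

  open RealField R
  open RealFieldProperties R
  open RingProperties (CommutativeRing.ring commutativeRing) using (-‿distribˡ-*)
  open HikeProperties R G
  open Hikes R G
  open Ranked ρ
  open RankFunction ρ using (rank; additive) renaming (cong to rank-cong)

  rank-[] : rank [] ≈ 0#
  rank-[] = begin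
    rank []                        ≈⟨ solve 1 (λ r → r := (r :+ r) :- r) refl (rank []) ⟩
    (rank [] + rank []) - rank []  ≈⟨ +-congʳ (additive [] []) ⟨
    rank [] - rank []              ≈⟨ -‿inverseʳ _ ⟩
    0#                             ∎
    where open ≈-Reasoning setoid

  abstract
    difference-∷ʳ : ∀ {v} h k d → v ≈ rank h - rank k → v - rank d ≈ rank h - rank (k ++ d)
    difference-∷ʳ {v} h k d v≈ = begin
      v - rank d                     ≈⟨ +-congʳ v≈ ⟩
      rank h - rank k - rank d       ≈⟨ solve 3 (λ h k d → h :- k :- d := h :- (k :+ d))
                                          refl (rank h) (rank k) (rank d) ⟩
      rank h - (rank k + rank d)     ≈⟨ +-congˡ (-‿cong (additive k d)) ⟨
      rank h - rank (k ++ d)         ∎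
      where open ≈-Reasoning setoid

  infixl 6 _⊖_
  -- Ranks form a group of differences, so the shifted value is again admissible: `d` joins the
  -- subtracted hike.
  _⊖_ : Rank → Hike → Rank
  (v , h , k , v≈) ⊖ d = v - rank d , h , k ++ d , difference-∷ʳ h k d v≈

  Tendsto-cong : ∀ {f g l m} → (∀ ϱ → f ϱ ≈ g ϱ) → l ≈ m → Tendsto f l → Tendsto g m
  Tendsto-cong f≈g l≈m f→l ε 0<ε with f→l ε 0<ε
  ... | N , f~l = N , λ ϱ N<ϱ →
    <-resp-≈ (f≈g ϱ) (+-congʳ l≈m) (proj₁ (f~l ϱ N<ϱ)) ,
    <-resp-≈ l≈m (+-congʳ (f≈g ϱ)) (proj₂ (f~l ϱ N<ϱ))

  Tendsto-0 : Tendsto (λ _ → 0#) 0#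
  Tendsto-0 ε 0<ε = 0# , λ _ _ → 0<0+ε , 0<0+ε
    where 0<0+ε = <-resp-≈ refl (sym (+-identityˡ ε)) 0<ε

  Tendsto-linear : ∀ {f g l m} a → Tendsto f l → Tendsto g m →
                   Tendsto (λ ϱ → f ϱ + a * g ϱ) (l + a * m)
  Tendsto-linear {f} {g} {l} {m} a f→l g→m ε 0<ε with positive-bound a
  ... | M , 0<M , a<M
    -- `K` is the error factor `1# + M + (M - a)` of `linear-<`; both limits are then taken with
    -- tolerance `ε / K`, written `ε * w`.
    with 0<K ← <-resp-≈ (trans (+-identityʳ _) (+-identityʳ _)) refl
                 (+-mono-< (+-mono-< 0<1 0<M) (x<y⇒0<y-x a<M))
    with positive-inverse 0<K
  ... | w , 0<w , wK≈1 with f→l (ε * w) (*-pos 0<ε 0<w) | g→m (ε * w) (*-pos 0<ε 0<w)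
  ... | N₁ , f~l | N₂ , g~m with common-bound N₁ N₂
  ... | N , N₁<N , N₂<N = N , λ ϱ N<ϱ →
    let f< , l< = f~l ϱ (<-trans N₁<N N<ϱ)
        g< , m< = g~m ϱ (<-trans N₂<N N<ϱ)
    in <-resp-≈ refl δK (linear-< 0<M a<M f< g< m<) ,
       <-resp-≈ refl δK (linear-< 0<M a<M l< m< g<)
    where
    δK : ∀ {x} → x + ε * w * (1# + M + (M - a)) ≈ x + ε
    δK = +-congˡ (trans (*-assoc _ _ _) (trans (*-congˡ wK≈1) (*-identityʳ ε)))

  Tendsto-shift : ∀ {f l} d → Tendsto f l → Tendsto (λ ϱ → f (ϱ ⊖ d)) l
  Tendsto-shift d f→l ε 0<ε with f→l ε 0<ε
  ... | N , f~l = N + rank d , λ ϱ N+d<ϱ → f~l (ϱ ⊖ d)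
    (x+z<y⇒x<y-z N+d<ϱ)

  -- Powers of `b` and the passage from normalised totals to ratios.

  module Exponential (b : Carrier) (0<b : 0# < b) (pow : Carrier → Carrier)
    (isExp : IsExponential b pow) where

    open IsExponential isExp

    pow-0 : (pow 0#) ≈ 1#
    pow-0 with positive-inverse 0<b
    ... | w , _ , wb≈1 = begin
      (pow 0#)                        ≈⟨ *-identityˡ _ ⟨
      1# * (pow 0#)                   ≈⟨ *-congʳ wb≈1 ⟨
      w * b * (pow 0#)                ≈⟨ *-assoc _ _ _ ⟩
      w * (b * (pow 0#))              ≈⟨ *-congˡ (*-congʳ pow-1) ⟨
      w * ((pow 1#) * (pow 0#))          ≈⟨ *-congˡ (pow-+ 1# 0#) ⟨
      w * (pow (1# + 0#))             ≈⟨ *-congˡ (pow-cong (+-identityʳ 1#)) ⟩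
      w * (pow 1#)                    ≈⟨ *-congˡ pow-1 ⟩
      w * b                        ≈⟨ wb≈1 ⟩
      1#                           ∎
      where open ≈-Reasoning setoid

    pow-inverse : ∀ x → (pow x) * (pow (- x)) ≈ 1#
    pow-inverse x = trans (sym (pow-+ x (- x))) (trans (pow-cong (-‿inverseʳ x)) pow-0)

    RatioTendsto-normalised : ∀ {f l S T C} → Tendsto f l → l # 0# →
      (∀ ϱ → T ϱ ≈ pow (value ϱ) * f ϱ) →
      Tendsto (λ ϱ → pow (- value ϱ) * S ϱ) (l * C) → RatioTendsto S T C
    RatioTendsto-normalised {f} {l} {S} {T} {C} f→l l#0 T≈ s→ ε 0<ε with halve (0<x*x l#0)
    -- Since `l * f` tends to `l * l`, it eventually exceeds the half `η` of that limit; `ε * η` is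
    -- the tolerance that `quotient-near` asks for.
    ... | η , 0<η , η+η≈l² with lf→l² η 0<η | u→0 (ε * η) (*-pos 0<ε 0<η)
      where
      lf→l² : Tendsto (λ ϱ → l * f ϱ) (l * l)
      lf→l² = Tendsto-cong (λ _ → +-identityˡ _) (+-identityˡ _) (Tendsto-linear l Tendsto-0 f→l)

      u→0 : Tendsto (λ ϱ → l * (pow (- value ϱ) * S ϱ - C * f ϱ)) 0#
      u→0 = Tendsto-cong (λ ϱ → trans (+-identityˡ _) (*-congˡ (+-congˡ (sym (-‿distribˡ-* C (f ϱ))))))
        (proportional-cancel l C)
        (Tendsto-linear l Tendsto-0 (Tendsto-linear (- C) s→ f→l))
    ... | N₁ , lf~l² | N₂ , u~0 with common-bound N₁ N₂
    ... | N , N₁<N , N₂<N = N , λ ϱ N<ϱ →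
      let η<lf = +-cancelʳ-< (<-resp-≈ (sym η+η≈l²) refl (proj₂ (lf~l² ϱ (<-trans N₁<N N<ϱ))))
          T#0  = factor#0 (pow-inverse (value ϱ)) (T≈ ϱ) (<-trans 0<η η<lf)
      in T#0 , quotient-near (pow-inverse (value ϱ)) (T≈ ϱ) (reciprocal T#0) 0<ε 0<η η<lf
                 (u~0 ϱ (<-trans N₂<N N<ϱ))

-- Splitting off one prime from a list of primes.

module Elimination {c ℓ₁ ℓ₂ : Level} (R : RealField c ℓ₁ ℓ₂) (G : WeightedDigraph R) where

  open RealField R
  open HikeProperties R G
  open Hikes R G

  cycleSetoid : Setoid ℓ₂ _
  cycleSetoid = DecSetoid.setoid cycleDecSetoid

  _⊥_ : Cycle → List Cycle → List Cycle
  p ⊥ L = filter (disjointFrom? p) L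

  Avoids : List Cycle → Pred Hike _
  Avoids L h = All (λ p → ¬ ([ p ] ∣ᵣ h)) L

  avoids? : ∀ L → Decidable (Avoids L)
  avoids? L h = All.all? (λ p → ¬? (divides? p h)) L

  Avoids-resp-≈ₕ : ∀ L {h k} → h ≈ₕ k → Avoids L h → Avoids L k
  Avoids-resp-≈ₕ L h≈k = All.map (λ p∤h p∣k → p∤h (∣ᵣ-resp-≈ₕ (≈-sym h≈k) p∣k))

  Avoids-∷ʳ⁻ : ∀ {p h} L → Avoids L (h ++ [ p ]) → Avoids (p ⊥ L) h
  Avoids-∷ʳ⁻ {p} L L∤hp = All.zipWith {Q = VertexDisjoint p}
    (λ {q} (q∤hp , p⊥q) q∣h → q∤hp (∣ᵣ-∷ʳ⁺ (disjoint-sym {p} {q} p⊥q) q∣h))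
    (All.filter⁺ (disjointFrom? p) L∤hp , All.all-filter (disjointFrom? p) L)

  -- The assumption on `L` is essential: `p` always divides `h ++ [ p ]`, yet it is absent from
  -- `p ⊥ L`.
  Avoids-∷ʳ⁺ : ∀ {p h L} → All (λ q → ¬ (p ~ q)) L → Avoids (p ⊥ L) h → Avoids L (h ++ [ p ])
  Avoids-∷ʳ⁺ {p} {h} {L} p∉L p⊥L∤h = All.tabulate λ {q} q∈L q∣hp →
    case ∣ᵣ-∷ʳ⁻ (λ q~p → All.lookup p∉L q∈L (~-sym {q} {p} q~p)) q∣hp of λ
      (q⊥p , q∣h) → All.lookup p⊥L∤h
        (∈-filter⁺ (disjointFrom? p) q∈L (disjoint-sym {q} {p} q⊥p)) q∣h

  SelfAvoidingOver : List Cycle → Pred Hike _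
  SelfAvoidingOver L h = SelfAvoiding h × All (λ q → Any (q ~_) L) h

  SelfAvoidingOver-⊥ : ∀ {p L h} → SelfAvoidingOver (p ⊥ L) h → All (VertexDisjoint p) h
  SelfAvoidingOver-⊥ {p} {L} (_ , h⊆) = All.map (λ {q} → disjoint {q}) h⊆
    where
    disjoint : ∀ {q} → Any (q ~_) (p ⊥ L) → VertexDisjoint p q
    disjoint {q} q∈ with All.lookupAny (All.all-filter (disjointFrom? p) L) q∈
    ... | p⊥r , q~r =
      disjoint-resp-~ {p} {p} {Any.lookup q∈} {q} (~-refl {p}) (~-sym {q} {Any.lookup q∈} q~r) p⊥r

  SelfAvoidingOver-∷ : ∀ {p L h} → SelfAvoidingOver L h → SelfAvoidingOver (p ∷ L) h
  SelfAvoidingOver-∷ (h! , h⊆L) = h! , All.map there h⊆L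

  SelfAvoidingOver-∷ʳ : ∀ {p L h} → SelfAvoidingOver (p ⊥ L) h → SelfAvoidingOver (p ∷ L) (h ++ [ p ])
  SelfAvoidingOver-∷ʳ {p} {L} {h} over@(h! , h⊆) =
    AllPairs.++⁺ h! ([] ∷ [])
      (All.map (λ {q} p⊥q → disjoint-sym {p} {q} p⊥q ∷ []) (SelfAvoidingOver-⊥ {p} {L} over)) ,
    All.++⁺ (All.map (λ q∈ → there (Any.filter⁻ (disjointFrom? p) q∈)) h⊆) (here (~-refl {p}) ∷ [])

  SelfAvoidingOver-¬∣ : ∀ {p L h} → All (λ q → ¬ (p ~ q)) L → SelfAvoidingOver L h → ¬ ([ p ] ∣ᵣ h)
  SelfAvoidingOver-¬∣ {p} {L} p∉L (_ , h⊆L) p∣h with ∣ᵣ⇒Removes p∣h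
  ... | _ , r with All.lookupAny h⊆L (Removes⇒∈ r)
  ... | q∈L , p~q with All.lookupAny p∉L (Any.map (λ {x} → ~-trans {p} {Any.lookup (Removes⇒∈ r)} {x} p~q) q∈L)
  ... | p≁x , p~x = p≁x p~x

  -- For a self-avoiding hike, containing `p` already means being divisible by it. The cofactor is
  -- disjoint from `p`, so none of its primes is `p` and all come from `p ⊥ L`.
  SelfAvoidingOver-split : ∀ {p L h} → SelfAvoidingOver (p ∷ L) h →
    SelfAvoidingOver L h ⊎ ∃[ k ] h ≈ₕ k ++ [ p ] × SelfAvoidingOver (p ⊥ L) k
  SelfAvoidingOver-split {p} {L} {h} (h! , h⊆) with Any.any? (p ~?_) h
  ... | yes p∈h with selfAvoiding-remove h! p∈h
  ... | k , r , p⊥k = inj₂ (k , Removes⇒≈∷ʳ r , Removes-AllPairs r h! ,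
          All.zipWith {Q = VertexDisjoint p} (λ {q} (q∈ , p⊥q) → restrict {q} q∈ p⊥q) (Removes-All r h⊆ , p⊥k))
    where
    restrict : ∀ {q} → Any (q ~_) (p ∷ L) → VertexDisjoint p q → Any (q ~_) (p ⊥ L)
    restrict {q} (here q~p)  p⊥q = contradiction (~-sym {q} {p} q~p) (disjoint⇒≁ {p} {q} p⊥q)
    restrict {q} (there q∈L) p⊥q = ∈ₚ.∈-filter⁺ cycleSetoid {P = VertexDisjoint p} (disjointFrom? p)
      (λ {x} {y} x~y → disjoint-resp-~ {p} {p} {x} {y} (~-refl {p}) x~y) {v = q} q∈L p⊥q
  SelfAvoidingOver-split {p} {L} {h} (h! , h⊆) | no p∉h =
    inj₁ (h! , All.zipWith (λ {q} (q∈ , p≁q) → restrict {q} q∈ p≁q) (h⊆ , All.¬Any⇒All¬ h p∉h))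
    where
    restrict : ∀ {q} → Any (q ~_) (p ∷ L) → ¬ (p ~ q) → Any (q ~_) L
    restrict {q} (here q~p)  p≁q = contradiction (~-sym {q} {p} q~p) p≁q
    restrict     (there q∈L) _   = q∈L

  -- The recursions for the totals and for the limiting constant.

  module Counting (ρ : RankFunction)
    (b : Carrier) (0<b : 0# < b) (pow : Carrier → Carrier) (isExp : IsExponential b pow)
    (f : Ranked.Rank ρ → Carrier) (l : Carrier) (f→l : Ranked.Tendsto ρ f l)
    (T₀ : Ranked.Rank ρ → Carrier)
    (T₀-total : ∀ ϱ → HasTotal (Ranked.OfRank ρ ϱ) weight (T₀ ϱ))
    (T₀≈ : ∀ ϱ → T₀ ϱ ≈ pow (Ranked.value ρ ϱ) * f ϱ) where

    open Ranked ρ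
    open RankFunction ρ using (rank; additive) renaming (cong to rank-cong)
    open RankProperties R G ρ
    open Exponential b 0<b pow isExp
    open IsExponential isExp
    open RealFieldProperties R using (solve; _:=_; _:+_; _:-_; _:*_; :-_)
    open RingProperties (CommutativeRing.ring commutativeRing)

    avoiding : ∀ L ϱ → ∃[ s ] HasTotal (λ h → OfRank ϱ h × Avoids L h) weight s
    avoiding L ϱ = HasTotal-filter (avoids? L) (Avoids-resp-≈ₕ L) (T₀-total ϱ)

    T : List Cycle → Rank → Carrier
    T L ϱ = proj₁ (avoiding L ϱ)

    T-[] : ∀ ϱ → T [] ϱ ≈ T₀ ϱ
    T-[] ϱ = HasTotal-functional weight-resp-≈ₕ
      (HasTotal-resp proj₁ (_, []) (proj₂ (avoiding [] ϱ))) (T₀-total ϱ)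

    -- There is no subtraction because the hikes counted by `T L ϱ` are sorted by divisibility by
    -- `p`.
    T-∷ : ∀ {p L} → All (λ q → ¬ (p ~ q)) L → ∀ ϱ →
          T L ϱ ≈ T (p ∷ L) ϱ + weightᶜ p * T (p ⊥ L) (ϱ ⊖ [ p ])
    T-∷ {p} {L} p∉L ϱ = HasTotal-functional weight-resp-≈ₕ (proj₂ (avoiding L ϱ))
      (HasTotal-split p
        (λ { (h∈ϱ , _ ∷ L∤h) → h∈ϱ , L∤h })
        (λ { {h} (h∈ϱ-p , p⊥L∤h) → trans (additive h [ p ]) (trans (+-congʳ h∈ϱ-p) (x-y+y≈x _ _))
                                 , Avoids-∷ʳ⁺ p∉L p⊥L∤h })
        (λ { (_ , p∤h ∷ _) → p∤h })
        split
        (λ {h} _ → trans (weight-∷ʳ h p) (*-comm _ _))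
        (proj₂ (avoiding (p ∷ L) ϱ)) (proj₂ (avoiding (p ⊥ L) (ϱ ⊖ [ p ]))))
      where
      x-y+y≈x : ∀ x y → x - y + y ≈ x
      x-y+y≈x = solve 2 (λ x y → x :- y :+ y := x) refl
      x+y-y≈x : ∀ x y → x + y - y ≈ x
      x+y-y≈x = solve 2 (λ x y → x :+ y :- y := x) refl
      split : ∀ {h} → OfRank ϱ h × Avoids L h → (OfRank ϱ h × Avoids (p ∷ L) h) ⊎
              ∃[ k ] h ≈ₕ k ++ [ p ] × OfRank (ϱ ⊖ [ p ]) k × Avoids (p ⊥ L) k
      split {h} (h∈ϱ , L∤h) with divides? p h
      ... | no p∤h = inj₁ (h∈ϱ , p∤h ∷ L∤h)
      ... | yes (k , h≈kp) = inj₂ (k , h≈kp ,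
        trans (sym (x+y-y≈x _ _)) (+-congʳ (trans (sym (additive k [ p ]))
          (trans (sym (rank-cong h≈kp)) h∈ϱ))) ,
        Avoids-∷ʳ⁻ L (Avoids-resp-≈ₕ L h≈kp L∤h))

    coefficient : Hike → Carrier
    coefficient d = μ d * weight d * pow (- rank d)

    -- The effect of one more prime on `coefficient`: a sign from `μ`, its weight, and its power of
    -- `b`.
    factor : Cycle → Carrier
    factor p = - (weightᶜ p * pow (- rank [ p ]))

    coefficient-∷ʳ : ∀ {p h} → SelfAvoiding h → SelfAvoiding (h ++ [ p ]) →
                     coefficient (h ++ [ p ]) ≈ factor p * coefficient h
    coefficient-∷ʳ {p} {h} h! hp! = begin
      μ (h ++ [ p ]) * weight (h ++ [ p ]) * pow (- rank (h ++ [ p ]))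
        ≈⟨ *-cong (*-cong μ-∷ʳ (weight-∷ʳ h p)) pow-∷ʳ ⟩
      - 1# * μ h * (weight h * weightᶜ p) * (pow (- rank h) * pow (- rank [ p ]))
        ≈⟨ *-congʳ (*-congʳ (-1*x≈-x (μ h))) ⟩
      - μ h * (weight h * weightᶜ p) * (pow (- rank h) * pow (- rank [ p ]))
        ≈⟨ rearrange (μ h) (weight h) (weightᶜ p) _ _ ⟩
      factor p * coefficient h ∎
      where
      open ≈-Reasoning setoid
      rearrange : ∀ m w x y z → - m * (w * x) * (y * z) ≈ - (x * z) * (m * w * y)
      rearrange = solve 5 (λ m w x y z →
        :- m :* (w :* x) :* (y :* z) := :- (x :* z) :* (m :* w :* y)) refl
      μ-∷ʳ : μ (h ++ [ p ]) ≈ - 1# * μ h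
      μ-∷ʳ = begin
        μ (h ++ [ p ])              ≡⟨ μ-selfAvoiding hp! ⟩
        (- 1#) ^ length (h ++ [ p ]) ≡⟨ ≡.cong ((- 1#) ^_) (≡.trans (List.length-++ h) (ℕ.+-comm _ 1)) ⟩
        - 1# * (- 1#) ^ length h    ≡⟨ ≡.cong (- 1# *_) (μ-selfAvoiding h!) ⟨
        - 1# * μ h                  ∎
      pow-∷ʳ : pow (- rank (h ++ [ p ])) ≈ pow (- rank h) * pow (- rank [ p ])
      pow-∷ʳ = trans (pow-cong (trans (-‿cong (additive h [ p ])) (sym (-‿+-comm _ _)))) (pow-+ _ _)

    -- Normalising by a power of `b`, not by `T₀`, keeps the recursion linear and avoids dividing by
    -- a total that may vanish; hence the limit `l * C`.
    Asymptotics : List Cycle → Set _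
    Asymptotics L = ∃[ C ] HasTotal (SelfAvoidingOver L) coefficient C ×
                           Tendsto (λ ϱ → pow (- value ϱ) * T L ϱ) (l * C)

    asymptotics-[] : Asymptotics []
    asymptotics-[] = 1# ,
      ([ [] ] , ([] , []) ∷ [] , (λ { [] _ → here ≈-nil ; (_ ∷ _) (_ , () ∷ _) }) , [] ∷ [] , sym coefficient-[]) ,
      Tendsto-cong T≈f (sym (*-identityʳ l)) f→l
      where
      open ≈-Reasoning setoid
      coefficient-[] : coefficient [] + 0# ≈ 1#
      coefficient-[] = begin
        1# * 1# * pow (- rank []) + 0#   ≈⟨ +-identityʳ _ ⟩
        1# * 1# * pow (- rank [])        ≈⟨ *-cong (*-identityˡ 1#) (pow-cong (trans (-‿cong rank-[]) -0#≈0#)) ⟩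
        1# * pow 0#                      ≈⟨ *-identityˡ _ ⟩
        pow 0#                           ≈⟨ pow-0 ⟩
        1#                               ∎
      T≈f : ∀ ϱ → f ϱ ≈ pow (- value ϱ) * T [] ϱ
      T≈f ϱ = begin
        f ϱ                                       ≈⟨ *-identityˡ _ ⟨
        1# * f ϱ                                  ≈⟨ *-congʳ (pow-inverse (value ϱ)) ⟨
        pow (value ϱ) * pow (- value ϱ) * f ϱ     ≈⟨ *-congʳ (*-comm _ _) ⟩
        pow (- value ϱ) * pow (value ϱ) * f ϱ     ≈⟨ *-assoc _ _ _ ⟩
        pow (- value ϱ) * (pow (value ϱ) * f ϱ)   ≈⟨ *-congˡ (T₀≈ ϱ) ⟨
        pow (- value ϱ) * T₀ ϱ                    ≈⟨ *-congˡ (T-[] ϱ) ⟨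
        pow (- value ϱ) * T [] ϱ                  ∎

    asymptotics-∷ : ∀ {p L} → All (λ q → ¬ (p ~ q)) L →
                    Asymptotics L → Asymptotics (p ⊥ L) → Asymptotics (p ∷ L)
    asymptotics-∷ {p} {L} p∉L (C₁ , C₁-total , T₁→) (C₂ , C₂-total , T₂→) =
      C₁ + factor p * C₂ ,
      HasTotal-split p SelfAvoidingOver-∷ (SelfAvoidingOver-∷ʳ {p} {L}) (SelfAvoidingOver-¬∣ p∉L)
        SelfAvoidingOver-split
        (λ over → coefficient-∷ʳ (proj₁ over) (proj₁ (SelfAvoidingOver-∷ʳ {p} {L} over)))
        C₁-total C₂-total ,
      Tendsto-cong T-step limit (Tendsto-linear (factor p) T₁→ (Tendsto-shift [ p ] T₂→))
      where
      open ≈-Reasoning setoid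
      limit : l * C₁ + factor p * (l * C₂) ≈ l * (C₁ + factor p * C₂)
      limit = solve 4 (λ l C a D → l :* C :+ a :* (l :* D) := l :* (C :+ a :* D)) refl l C₁ (factor p) C₂
      T-step : ∀ ϱ → pow (- value ϱ) * T L ϱ +
                     factor p * (pow (- value (ϱ ⊖ [ p ])) * T (p ⊥ L) (ϱ ⊖ [ p ])) ≈
                     pow (- value ϱ) * T (p ∷ L) ϱ
      -- The shifted total is normalised at its own rank `ϱ ⊖ [ p ]`; the remaining power
      -- `pow (- rank [ p ])` is part of `factor p`.
      T-step ϱ = step (T-∷ p∉L ϱ) pow-split
        where
        pow-split : pow (- (value ϱ - rank [ p ])) * pow (- rank [ p ]) ≈ pow (- value ϱ)
        pow-split = trans (sym (pow-+ _ _)) (pow-cong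
          (solve 2 (λ v r → :- (v :- r) :+ :- r := :- v) refl (value ϱ) (rank [ p ])))
        step : ∀ {t t₁ t₂ w x y z} → t₁ ≈ t + w * t₂ → x * y ≈ z →
               z * t₁ + - (w * y) * (x * t₂) ≈ z * t
        step {t} {t₁} {t₂} {w} {x} {y} {z} t₁≈ xy≈z = begin
          z * t₁ + - (w * y) * (x * t₂)             ≈⟨ +-congʳ (*-cong (sym xy≈z) t₁≈) ⟩
          x * y * (t + w * t₂) + - (w * y) * (x * t₂) ≈⟨ solve 5 (λ t u w x y →
            x :* y :* (t :+ w :* u) :+ :- (w :* y) :* (x :* u) := x :* y :* t) refl t t₂ w x y ⟩
          x * y * t                                 ≈⟨ *-congʳ xy≈z ⟩
          z * t                                     ∎

    -- The bound `n` carries the recursion because `p ⊥ L` is shorter than `p ∷ L` without being a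
    -- subterm of it.
    asymptotics : ∀ n L → length L ≤ℕ n → Distinct L → Asymptotics L
    asymptotics _       []      _         _          = asymptotics-[]
    asymptotics (suc n) (p ∷ L) (s≤s L≤n) (p∉L ∷ L!) =
      asymptotics-∷ p∉L (asymptotics n L L≤n L!)
        (asymptotics n (p ⊥ L) (ℕ.≤-trans (List.length-filter (disjointFrom? p) L) L≤n)
          (AllPairs.filter⁺ (disjointFrom? p) L!))

  -- From a list of representatives back to all primes on `H`.

  module _ (H : Subset (WeightedDigraph.order G)) {L : List Cycle} (L⊆H : All (IsPrimeOn H) L)
    (L-complete : ∀ p → IsPrimeOn H p → Any (p ~_) L) where

    Avoids⇒NotMultipleOfPrimeOn : ∀ {h} → Avoids L h → NotMultipleOfPrimeOn H h
    Avoids⇒NotMultipleOfPrimeOn {h} L∤h p p⊆H p∣h with All.lookupAny L∤h (L-complete p p⊆H)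
    ... | q∤h , p~q = q∤h (∣ᵣ-resp-~ {p} p~q p∣h)

    NotMultipleOfPrimeOn⇒Avoids : ∀ {h} → NotMultipleOfPrimeOn H h → Avoids L h
    NotMultipleOfPrimeOn⇒Avoids H∤h = All.map (λ {p} → H∤h p) L⊆H

    SelfAvoidingOver⇒On : ∀ {h} → SelfAvoidingOver L h → SelfAvoidingOn H h
    SelfAvoidingOver⇒On (h! , h⊆L) = h! , All.map (λ {q} → primeOn {q}) h⊆L
      where
      primeOn : ∀ {q} → Any (q ~_) L → IsPrimeOn H q
      primeOn {q} q∈L with All.lookupAny L⊆H q∈L
      ... | r⊆H , q~r = IsPrimeOn-resp-~ H {Any.lookup q∈L} {q} (~-sym {q} {Any.lookup q∈L} q~r) r⊆H

    SelfAvoidingOn⇒Over : ∀ {h} → SelfAvoidingOn H h → SelfAvoidingOver L h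
    SelfAvoidingOn⇒Over (h! , h⊆H) = h! , All.map (λ {q} → L-complete q) h⊆H

mainTheorem3 :
    {c ℓ₁ ℓ₂ : Level} (R : RealField c ℓ₁ ℓ₂) (G : WeightedDigraph R) →
    let open RealField R
        open Hikes R G in
    (H : Subset (WeightedDigraph.order G)) (ρ : RankFunction) →
    let open Ranked ρ
        open RankFunction ρ using (rank) in
    (b : Carrier) → 0# < b →
    (b^_ : Carrier → Carrier) → IsExponential b b^_ →
    (f : Rank → Carrier) → Bounded f →
    (l : Carrier) → Tendsto f l → l # 0# →
    (∣ℋ∣ : Rank → Carrier) →
    (∀ ϱ → HasTotal (OfRank ϱ) weight (∣ℋ∣ ϱ)) →
    (∀ ϱ → ∣ℋ∣ ϱ ≈ (b^ (value ϱ)) * f ϱ) →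
    ∃₂ λ (S : Rank → Carrier) (C : Carrier) →
      (∀ ϱ → HasTotal (λ h → OfRank ϱ h × NotMultipleOfPrimeOn H h) weight (S ϱ)) ×
      HasTotal (SelfAvoidingOn H) (λ d → μ d * weight d * (b^ (- rank d))) C ×
      RatioTendsto S ∣ℋ∣ C
mainTheorem3 R G H ρ b 0<b pow isExp f _ l f→l l#0 ∣ℋ∣ ∣ℋ∣-total ∣ℋ∣≈ =
  let L , L! , L⊆H , L-complete = primesOn H
      C , C-total , T→          = asymptotics (length L) L ℕ.≤-refl L!
  in T L , C ,
     (λ ϱ → HasTotal-resp
       (λ (h∈ϱ , L∤h) → h∈ϱ , Avoids⇒NotMultipleOfPrimeOn H L⊆H L-complete L∤h)
       (λ (h∈ϱ , H∤h) → h∈ϱ , NotMultipleOfPrimeOn⇒Avoids H L⊆H L-complete H∤h)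
       (proj₂ (avoiding L ϱ))) ,
     HasTotal-resp (SelfAvoidingOver⇒On H L⊆H L-complete) (SelfAvoidingOn⇒Over H L⊆H L-complete)
       C-total ,
     RatioTendsto-normalised f→l l#0 ∣ℋ∣≈ T→
  where
  open HikeProperties R G
  open Hikes R G
  open Elimination R G
  open Counting ρ b 0<b pow isExp f l f→l ∣ℋ∣ ∣ℋ∣-total ∣ℋ∣≈
  open RankProperties R G ρ
  open Exponential b 0<b pow isExp
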